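{- Let $F\in\mathcal{F}_n$. The map $\delta_{321}$ sending a $321$-avoiding full rook placement $R$ on $F$ to $(D_{R,F},D_F)$, where $D_{R,F}$ is the Dyck path with height sequence $j_i=2\ell_i-h_i$ ($0\le i\le 2n$), is a bijection from the set $\mathcal{R}_F(321)$ of $321$-avoiding full rook placements on $F$ onto $\mathcal{D}^2_F$. Consequently there is a bijection $\mathcal{M}_F(321)\to\mathcal{D}^2_F$.
   Context: A Dyck path of semilength $n$ is a lattice path from $(0,n)$ to $(n,0)$ with unit east and south steps never going strictly below $y=n-x$; $\mathcal{D}_n$ is their set. $\mathcal{F}_n$ is the set of Ferrers boards (sets of unit squares bounded by the coordinate axes and a path) whose border $D_F$ is such a Dyck path; border vertices $V_0=(0,n),\dots,V_{2n}=(n,0)$ in order. The height sequence of a Dyck path is $d_0=0$, $d_{i+1}=d_i+1$ if step $i+1$ is east and $d_i-1$ if south; $h_0\dots h_{2n}$ denotes that of $D_F$. $\mathcal{D}^2_F$ is the set of pairs $(D_0,D_F)$, $D_0\in\mathcal{D}_n$, with $D_0$ never strictly above $D_F$. A full rook placement $R$ on $F$ has exactly one square in each row and column of $F$; $\Gamma(V)$ for $V=(a,b)$ is the set of unit squares in $[0,a]\times[0,b]$; a set of squares with at most one per row and column determines a permutation by standardizing. $R$ avoids $\tau$ if for every border vertex $V$ the permutation determined by $R\cap\Gamma(V)$ avoids $\tau$. $\ell_i$ is the length of the longest increasing subsequence of the permutation determined by $R\cap\Gamma(V_i)$ (it is known that $j_i$ so defined is the height sequence of a Dyck path weakly below $D_F$).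 Matchings: $\mathcal{M}_F(\tau)$ is the set of perfect matchings $M$ of $[2n]$ whose shape is $F$ (border read from $1$ to $2n$: east step for each opener, south for each closer) that avoid $\tau\in S_k$, i.e. there are no $i_1<\dots<i_{2k}$ with all pairs $(i_a,i_{2k+1-\tau(a)})$ in $M$. -}

module Defs where

open import Data.Nat using (ℕ; zero; suc; _+_; _*_; _∸_; _≤_; _<_; _≤?_; _<?_; _⊔_)
open import Data.Bool using (Bool; true; false)
open import Data.Integer as ℤ using (ℤ; +_; _-_)
open import Data.List using (List; []; _∷_; length; take; filter)
open import Data.Product using (Σ; _×_; ∃; ∃-syntax)
open import Relation.Nullary using (¬_; yes; no)
open import Relation.Binary.PropositionalEquality using (_≡_)

-- Lattice paths: a list of steps, true = east, false = south.
-- Indices are 0-based: the step number i+1 of the paper is entry i.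

ec : List Bool → ℕ → ℕ
ec _ zero = zero
ec [] (suc i) = zero
ec (true ∷ D) (suc i) = suc (ec D i)
ec (false ∷ D) (suc i) = ec D i

sc : List Bool → ℕ → ℕ
sc _ zero = zero
sc [] (suc i) = zero
sc (true ∷ D) (suc i) = sc D i
sc (false ∷ D) (suc i) = suc (sc D i)

ht : List Bool → ℕ → ℤ
ht D i = + ec D i - + sc D i

-- entry i of a list (default value outside the range; always guarded)
getB : List Bool → ℕ → Bool
getB [] _ = false
getB (b ∷ _) zero = b
getB (_ ∷ D) (suc i) = getB D i

get : List ℕ → ℕ → ℕ
get [] _ = zero
get (x ∷ _) zero = x
get (_ ∷ xs) (suc i) = get xs i

-- Dyck paths of semilength n from (0,n) to (n,0), never strictly below
-- y = n - x (equivalently all heights ≥ 0, ending at height 0).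
Dyck : ℕ → List Bool → Set
Dyck n D = (length D ≡ 2 * n)
         × (∀ i → i ≤ 2 * n → + 0 ℤ.≤ ht D i)
         × (ht D (2 * n) ≡ + 0)

-- D₀ never strictly above D (both from (0,n)): the i-th vertices lie on
-- the same antidiagonal, so this is a pointwise comparison of heights.
Below : ℕ → List Bool → List Bool → Set
Below n D₀ D = ∀ i → i ≤ 2 * n → ht D₀ i ℤ.≤ ht D i

InD² : ℕ → List Bool → List Bool → Set
InD² n D D₀ = Dyck n D₀ × Below n D₀ D

-- Ferrers board F with border D (a Dyck path of semilength n).
-- Border vertex V_i = (X i , Y i).

X : List Bool → ℕ → ℕ
X D i = ec D i

Y : ℕ → List Bool → ℕ → ℕ
Y n D i = n ∸ sc D i

-- the unit square [c,c+1]×[r,r+1] belongs to F iff it lies below an east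
-- step of the border: step i+1 goes from V_i with X = c, and r < Y(V_i).
InF : ℕ → List Bool → ℕ → ℕ → Set
InF n D c r = ∃[ i ] (i < 2 * n) × (getB D i ≡ true) × (X D i ≡ c) × (r < Y n D i)

-- Rook placements: R is the list of rows of the rooks, column by column
-- (entry c = row of the rook in column c, columns 0..n-1 of F).

FullRook : ℕ → List Bool → List ℕ → Set
FullRook n D R = (length R ≡ n)
               × (∀ c → c < n → InF n D c (get R c))
               × (∀ r → (∃[ c ] InF n D c r) →
                     (∃[ c ] (c < n) × (get R c ≡ r))
                   × (∀ c c' → c < n → c' < n → get R c ≡ r → get R c' ≡ r → c ≡ c'))

InΓ : ℕ → List Bool → List ℕ → ℕ → ℕ → Set
InΓ n D R i c = (c < X D i) × (get R c < Y n D i)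

Has321 : ℕ → List Bool → List ℕ → ℕ → Set
Has321 n D R i = ∃[ c₁ ] ∃[ c₂ ] ∃[ c₃ ]
    (c₁ < c₂) × (c₂ < c₃)
  × InΓ n D R i c₁ × InΓ n D R i c₂ × InΓ n D R i c₃
  × (get R c₂ < get R c₁) × (get R c₃ < get R c₂)

Avoids321 : ℕ → List Bool → List ℕ → Set
Avoids321 n D R = ∀ i → i ≤ 2 * n → ¬ Has321 n D R i

R321 : ℕ → List Bool → List ℕ → Set
R321 n D R = FullRook n D R × Avoids321 n D R

lisGe : ℕ → List ℕ → ℕ
lisGe b [] = zero
lisGe b (x ∷ xs) with b ≤? x
... | yes _ = suc (lisGe (suc x) xs) ⊔ lisGe b xs
... | no _ = lisGe b xs

lis : List ℕ → ℕ
lis = lisGe zero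

ell : ℕ → List Bool → List ℕ → ℕ → ℕ
ell n D R i = lis (filter (λ r → r <? Y n D i) (take (X D i) R))

jseq : ℕ → List Bool → List ℕ → ℕ → ℤ
jseq n D R i = + (2 * ell n D R i) - ht D i

-- Perfect matchings of [2n], as partner lists: entry i (0-based position
-- i+1) is the (0-based) partner of i.

PerfectMatching : ℕ → List ℕ → Set
PerfectMatching n M = (length M ≡ 2 * n)
                    × (∀ i → i < 2 * n → get M i < 2 * n)
                    × (∀ i → i < 2 * n → ¬ (get M i ≡ i))
                    × (∀ i → i < 2 * n → get M (get M i) ≡ i)

HasShape : ℕ → List Bool → List ℕ → Set
HasShape n D M = ∀ i → i < 2 * n →
  ((i < get M i → getB D i ≡ true) × (getB D i ≡ true → i < get M i))

Avoids321M : ℕ → List ℕ → Set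
Avoids321M n M = ¬ (∃[ i₁ ] ∃[ i₂ ] ∃[ i₃ ] ∃[ i₄ ] ∃[ i₅ ] ∃[ i₆ ]
    (i₁ < i₂) × (i₂ < i₃) × (i₃ < i₄) × (i₄ < i₅) × (i₅ < i₆) × (i₆ < 2 * n)
  × (get M i₁ ≡ i₄) × (get M i₂ ≡ i₅) × (get M i₃ ≡ i₆))

M321 : ℕ → List Bool → List ℕ → Set
M321 n D M = PerfectMatching n M × HasShape n D M × Avoids321M n M

{-# OPTIONS --safe #-}
module Submission where

-- Insertion into a tableau commutes with discarding its large entries. The state therefore carries
-- the bound on the rows as its length, and nearly every fact is an induction that peels off the
-- highest row. Fullness enters through the count: a row that the border leaves behind must already
-- hold a rook, since no later column reaches it. So the entry deleted at a south step exists, and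
-- the number of entries is h_i. The lengths of the two rows are then ℓ_i and h_i - ℓ_i, and the
-- difference of these is j_i. The obstacle is that a tableau forgets in which columns its entries
-- were read, while a 321 is a statement about columns. The bridge is a correspondence, kept along
-- the whole border, between descents of the word read so far and pairs of a second-row entry above
-- a first-row entry. It turns a 321 into a failing insertion and a failing insertion into a 321.

-- Read the border from left to right and keep the two-row RS insertion tableau of R ∩ Γ(V_i): an
-- east step inserts the row of the rook of the new column, a south step deletes the largest entry.
-- The first row has length ℓ_i and the placement avoids 321 exactly when no insertion bumps an entry
-- out of the second row, so j_i = 2ℓ_i - h_i is the difference of the two row lengths. Backwards
-- every step is determined by its effect on the row lengths, that is by the pair (D₀, D): this
-- recovers R, and the ballot condition on tableaux makes the reverse steps possible for every
-- D₀ weakly below D.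
-- A matching corresponds to the placement with a rook in the column of each opener and the row of
-- its partner; since rows are numbered from the bottom, the 321-patterns match.

open import Defs
open import Data.Nat
open import Data.Nat.Properties
open import Data.Integer as ℤ using (ℤ; +_; _-_)
import Data.Integer.Properties as ℤₚ
import Data.Integer.Tactic.RingSolver as ℤ-Solver
open import Data.Bool using (Bool; true; false; not; if_then_else_)
open import Data.Bool.Properties using (not-injective)
open import Data.List
  using (List; []; _∷_; _++_; length; take; filter; applyUpTo; map; replicate)
open import Data.List.Properties
  using ( ++-assoc; ++-identityʳ; length-++; length-replicate; length-take; length-map
        ; length-applyUpTo; filter-++; filter-accept; filter-reject )
open import Data.Product using (Σ; _×_; _,_; ∃-syntax; proj₁; proj₂)
open import Data.Sum using (_⊎_; inj₁; inj₂)
open import Data.Empty using (⊥-elim)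
open import Data.Unit using (⊤; tt)
open import Relation.Nullary using (¬_; yes; no; contradiction)
open import Relation.Nullary.Decidable using (⌊_⌋)
open import Relation.Binary.Definitions using (tri<; tri≈; tri>)
open import Relation.Binary.PropositionalEquality
  using (_≡_; _≢_; refl; sym; trans; cong; cong₂; subst; subst₂; module ≡-Reasoning)
open import Algebra.Properties.CommutativeSemigroup ⊔-commutativeSemigroup using (interchange)

-- Longest increasing subsequences

lisGe-snoc-< : ∀ {b x} w → x < b → lisGe b (w ++ x ∷ []) ≡ lisGe b w
lisGe-snoc-< {b} {x} [] x<b with b ≤? x
... | yes b≤x = contradiction b≤x (<⇒≱ x<b)
... | no _ = refl
lisGe-snoc-< {b} {x} (y ∷ w) x<b with b ≤? y
... | yes b≤y = cong₂ (λ u v → suc u ⊔ v)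
                  (lisGe-snoc-< w (<-≤-trans x<b (m≤n⇒m≤1+n b≤y))) (lisGe-snoc-< w x<b)
... | no _ = lisGe-snoc-< w x<b

-- An increasing subsequence either stays inside `w` or consists of entries below `x` followed by
-- `x` itself.
lisGe-snoc-≥ : ∀ {b x} w → b ≤ x →
  lisGe b (w ++ x ∷ []) ≡ lisGe b w ⊔ suc (lisGe b (filter (_<? x) w))
lisGe-snoc-≥ {b} {x} [] b≤x with b ≤? x
... | yes _ = refl
... | no b≰x = contradiction b≤x b≰x
lisGe-snoc-≥ {b} {x} (y ∷ w) b≤x with y <? x
... | yes y<x rewrite filter-accept (_<? x) {y} {w} y<x with b ≤? y
...   | yes b≤y rewrite lisGe-snoc-≥ w y<x | lisGe-snoc-≥ w b≤x =
          interchange (suc (lisGe (suc y) w)) (suc (suc (lisGe (suc y) (filter (_<? x) w))))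
            (lisGe b w) (suc (lisGe b (filter (_<? x) w)))
...   | no _ = lisGe-snoc-≥ w b≤x
lisGe-snoc-≥ {b} {x} (y ∷ w) b≤x | no y≮x rewrite filter-reject (_<? x) {y} {w} y≮x with b ≤? y
-- What follows `y ≥ x` is bounded below by `suc y > x`, so a subsequence through `y` cannot use the
-- new entry.
...   | yes b≤y rewrite lisGe-snoc-< w (s≤s (≮⇒≥ y≮x)) | lisGe-snoc-≥ w b≤x =
          sym (⊔-assoc (suc (lisGe (suc y) w)) (lisGe b w) (suc (lisGe b (filter (_<? x) w))))
...   | no _ = lisGe-snoc-≥ w b≤x

filter-<-snoc-≥ : ∀ {y x} w → y ≤ x → filter (_<? y) (w ++ x ∷ []) ≡ filter (_<? y) w
filter-<-snoc-≥ {y} {x} w y≤x = begin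
  filter (_<? y) (w ++ x ∷ [])                 ≡⟨ filter-++ (_<? y) w _ ⟩
  filter (_<? y) w ++ filter (_<? y) (x ∷ [])  ≡⟨ cong (filter (_<? y) w ++_) (filter-reject (_<? y) (≤⇒≯ y≤x)) ⟩
  filter (_<? y) w ++ []                       ≡⟨ ++-identityʳ _ ⟩
  filter (_<? y) w                             ∎
  where open ≡-Reasoning

filter-<-filter-< : ∀ {x y} w → x ≤ y → filter (_<? x) (filter (_<? y) w) ≡ filter (_<? x) w
filter-<-filter-< [] x≤y = refl
filter-<-filter-< {x} {y} (z ∷ w) x≤y with z <? y
... | no z≮y rewrite filter-reject (_<? y) {z} {w} z≮y
                   | filter-reject (_<? x) {z} {w} (λ z<x → z≮y (<-≤-trans z<x x≤y)) = filter-<-filter-< w x≤y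
... | yes z<y rewrite filter-accept (_<? y) {z} {w} z<y with z <? x
...   | yes z<x rewrite filter-accept (_<? x) {z} {filter (_<? y) w} z<x
                      | filter-accept (_<? x) {z} {w} z<x = cong (z ∷_) (filter-<-filter-< w x≤y)
...   | no z≮x rewrite filter-reject (_<? x) {z} {filter (_<? y) w} z≮x
                     | filter-reject (_<? x) {z} {w} z≮x = filter-<-filter-< w x≤y

-- Both terms on the right are the same function of a bound, taken at `y` and at `x`. This closed
-- recursion is the one that row insertion reproduces.
lis-filter-snoc : ∀ {y x} w → x < y →
  lis (filter (_<? y) (w ++ x ∷ [])) ≡ lis (filter (_<? y) w) ⊔ suc (lis (filter (_<? x) w))
lis-filter-snoc {y} {x} w x<y
  rewrite filter-++ (_<? y) w (x ∷ []) | filter-accept (_<? y) {x} {[]} x<y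
        | lisGe-snoc-≥ {0} {x} (filter (_<? y) w) z≤n | filter-<-filter-< w (<⇒≤ x<y) = refl

-- Two-row insertion tableaux

-- A tableau with entries below y is encoded by y labels: first or second if the number lies in that
-- row, free if it does not occur.
data Label : Set where
  free first second : Label

-- The head of a list of labels belongs to the highest row.
data At : List Label → ℕ → Label → Set where
  here  : ∀ {l s q} → q ≡ length s → At (l ∷ s) q l
  there : ∀ {l s q k} → At s q k → At (l ∷ s) q k

firsts seconds : List Label → ℕ
firsts [] = 0
firsts (first ∷ s) = suc (firsts s)
firsts (_ ∷ s) = firsts s
seconds [] = 0
seconds (second ∷ s) = suc (seconds s)
seconds (_ ∷ s) = seconds s

-- Row insertion of r. The index is true if r is appended to the first row and false if it bumps an
-- entry, which must exceed the whole second row. It is thus the step of D₀: j grows or shrinks by 1.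
data Ins : Bool → List Label → List Label → ℕ → Set where
  place       : ∀ {s r} → r ≡ length s → Ins true (free ∷ s) (first ∷ s) r
  bump        : ∀ {s s' r} → Ins true s s' r → Ins false (first ∷ s) (second ∷ s') r
  skip-free   : ∀ {b s s' r} → Ins b s s' r → Ins b (free ∷ s) (free ∷ s') r
  skip-second : ∀ {s s' r} → Ins true s s' r → Ins true (second ∷ s) (second ∷ s') r
  skip-first  : ∀ {s s' r} → Ins false s s' r → Ins false (first ∷ s) (first ∷ s') r

-- The states along the paths D and D₀. Deleting the largest entry from the second row leaves ℓ
-- unchanged while h drops, so that step of D₀ goes up.
data Run : List Label → List Bool → List ℕ → List Bool → Set where
  done         : Run [] [] [] []
  east         : ∀ {b s s' r D R D₀} → Ins b s s' r → Run s' D R D₀ →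
                 Run s (true ∷ D) (r ∷ R) (b ∷ D₀)
  south-first  : ∀ {s D R D₀} → Run s D R D₀ → Run (first ∷ s) (false ∷ D) R (false ∷ D₀)
  south-second : ∀ {s D R D₀} → Run s D R D₀ → Run (second ∷ s) (false ∷ D) R (true ∷ D₀)

-- Labels before and after an insertion

At-< : ∀ {s q k} → At s q k → q < length s
At-< (here refl) = ≤-refl
At-< (there p) = m≤n⇒m≤1+n (At-< p)

At-unique : ∀ {s q k k'} → At s q k → At s q k' → k ≡ k'
At-unique (here _) (here _) = refl
At-unique (here e) (there p) = contradiction (At-< p) (<-irrefl e)
At-unique (there p) (here e) = contradiction (At-< p) (<-irrefl e)
At-unique (there p) (there p') = At-unique p p'

At-total : ∀ s {q} → q < length s → ∃[ k ] At s q k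
At-total (l ∷ s) (s≤s q≤) with m≤n⇒m<n∨m≡n q≤
... | inj₂ e = l , here e
... | inj₁ q< = let k , p = At-total s q< in k , there p

Ins-length : ∀ {b s s' r} → Ins b s s' r → length s ≡ length s'
Ins-length (place _) = refl
Ins-length (bump i) = cong suc (Ins-length i)
Ins-length (skip-free i) = cong suc (Ins-length i)
Ins-length (skip-second i) = cong suc (Ins-length i)
Ins-length (skip-first i) = cong suc (Ins-length i)

Ins-free : ∀ {b s s' r} → Ins b s s' r → At s r free
Ins-free (place e) = here e
Ins-free (bump i) = there (Ins-free i)
Ins-free (skip-free i) = there (Ins-free i)
Ins-free (skip-second i) = there (Ins-free i)
Ins-free (skip-first i) = there (Ins-free i)

Ins-first : ∀ {b s s' r} → Ins b s s' r → At s' r first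
Ins-first (place e) = here e
Ins-first (bump i) = there (Ins-first i)
Ins-first (skip-free i) = there (Ins-first i)
Ins-first (skip-second i) = there (Ins-first i)
Ins-first (skip-first i) = there (Ins-first i)

Ins-true-no-first-above : ∀ {s s' r q} → Ins true s s' r → r < q → ¬ At s q first
Ins-true-no-first-above (place refl) r<q (there p) = <-asym r<q (At-< p)
Ins-true-no-first-above (skip-free i) r<q (there p) = Ins-true-no-first-above i r<q p
Ins-true-no-first-above (skip-second i) r<q (there p) = Ins-true-no-first-above i r<q p

-- The witness is the bumped entry: it is the least first-row entry above `r`, hence at most `q`.
Ins-second-above : ∀ {b s s' r q} → Ins b s s' r → r < q → At s q first →
  ∃[ a ] r < a × a ≤ q × At s' a second
Ins-second-above (place refl) r<q (there p) = contradiction (At-< p) (<-asym r<q)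
Ins-second-above (bump i) r<q (here e) = _ , r<q , ≤-refl , here (trans e (Ins-length i))
Ins-second-above (bump i) r<q (there p) = contradiction p (Ins-true-no-first-above i r<q)
Ins-second-above (skip-free i) r<q (there p) =
  let a , r<a , a≤q , p' = Ins-second-above i r<q p in a , r<a , a≤q , there p'
Ins-second-above (skip-second i) r<q (there p) = contradiction p (Ins-true-no-first-above i r<q)
Ins-second-above (skip-first i) r<q (there p) =
  let a , r<a , a≤q , p' = Ins-second-above i r<q p in a , r<a , a≤q , there p'
Ins-second-above (skip-first i) r<q (here refl) =
  let a , r<a , a≤ , p = go i in a , r<a , a≤ , there p
  where
  -- The index `false` alone guarantees that some entry was bumped.
  go : ∀ {s s' r} → Ins false s s' r → ∃[ a ] r < a × a ≤ length s × At s' a second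
  go (bump i) = _ , At-< (Ins-free i) , n≤1+n _ , here (Ins-length i)
  go (skip-free i) = let a , r<a , a≤ , p = go i in a , r<a , m≤n⇒m≤1+n a≤ , there p
  go (skip-first i) = let a , r<a , a≤ , p = go i in a , r<a , m≤n⇒m≤1+n a≤ , there p

Ins-keeps-second : ∀ {b s s' r q} → Ins b s s' r → At s q second → At s' q second
Ins-keeps-second (place _) (there p) = there p
Ins-keeps-second (bump i) (there p) = there (Ins-keeps-second i p)
Ins-keeps-second (skip-free i) (there p) = there (Ins-keeps-second i p)
Ins-keeps-second (skip-second i) (here e) = here (trans e (Ins-length i))
Ins-keeps-second (skip-second i) (there p) = there (Ins-keeps-second i p)
Ins-keeps-second (skip-first i) (there p) = there (Ins-keeps-second i p)

Ins-true-keeps-first : ∀ {s s' r q} → Ins true s s' r → At s q first → At s' q first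
Ins-true-keeps-first (place _) (there p) = there p
Ins-true-keeps-first (skip-free i) (there p) = there (Ins-true-keeps-first i p)
Ins-true-keeps-first (skip-second i) (there p) = there (Ins-true-keeps-first i p)

-- Only the bumped entry leaves the first row, and it becomes the largest entry of the second row;
-- `q < q'` shows that `q` is not that entry.
Ins-keeps-first : ∀ {b s s' r q q'} → Ins b s s' r → At s q first → At s q' second → q < q' →
  At s' q first
Ins-keeps-first {true} i p _ _ = Ins-true-keeps-first i p
Ins-keeps-first (bump i) (here refl) (there p') q<q' = contradiction (At-< p') (<-asym q<q')
Ins-keeps-first (bump i) (there p) _ _ = there (Ins-true-keeps-first i p)
Ins-keeps-first {false} (skip-free i) (there p) (there p') q<q' = there (Ins-keeps-first i p p' q<q')
Ins-keeps-first (skip-first i) (here refl) (there p') q<q' = here (Ins-length i)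
Ins-keeps-first (skip-first i) (there p) (there p') q<q' = there (Ins-keeps-first i p p' q<q')

Ins-first⁻ : ∀ {b s s' r q} → Ins b s s' r → At s' q first → q ≡ r ⊎ At s q first
Ins-first⁻ (place refl) (here e) = inj₁ e
Ins-first⁻ (place _) (there p) = inj₂ (there p)
Ins-first⁻ (bump i) (there p) with Ins-first⁻ i p
... | inj₁ e = inj₁ e
... | inj₂ p' = inj₂ (there p')
Ins-first⁻ (skip-free i) (there p) with Ins-first⁻ i p
... | inj₁ e = inj₁ e
... | inj₂ p' = inj₂ (there p')
Ins-first⁻ (skip-second i) (there p) with Ins-first⁻ i p
... | inj₁ e = inj₁ e
... | inj₂ p' = inj₂ (there p')
Ins-first⁻ (skip-first i) (here e) = inj₂ (here (trans e (sym (Ins-length i))))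
Ins-first⁻ (skip-first i) (there p) with Ins-first⁻ i p
... | inj₁ e = inj₁ e
... | inj₂ p' = inj₂ (there p')

-- The second alternative describes the bumped entry; its last component is the minimality of that
-- entry among the first-row entries above `r`.
Ins-second⁻ : ∀ {b s s' r q} → Ins b s s' r → At s' q second →
  At s q second ⊎ (r < q × At s q first × (∀ {x} → At s x first → x < q → x ≤ r))
Ins-second⁻ (place _) (there p) = inj₁ (there p)
Ins-second⁻ {r = r} (bump {s} {s'} i) (here e) =
  inj₂ (subst (r <_) (sym e') (At-< (Ins-free i)) , here e' , low)
  where
  e' = trans e (sym (Ins-length i))
  low : ∀ {x} → At (first ∷ s) x first → x < _ → x ≤ r
  low (here refl) x<q = contradiction x<q (<-irrefl (sym e'))
  low (there p) _ = ≮⇒≥ (λ r<x → Ins-true-no-first-above i r<x p)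
Ins-second⁻ (bump i) (there p) with Ins-second⁻ i p
... | inj₁ p' = inj₁ (there p')
... | inj₂ (r<q , p' , _) = contradiction p' (Ins-true-no-first-above i r<q)
Ins-second⁻ (skip-free i) (there p) with Ins-second⁻ i p
... | inj₁ p' = inj₁ (there p')
... | inj₂ (r<q , p' , low) = inj₂ (r<q , there p' , λ { (there u) → low u })
Ins-second⁻ (skip-second i) (here e) = inj₁ (here (trans e (sym (Ins-length i))))
Ins-second⁻ (skip-second i) (there p) with Ins-second⁻ i p
... | inj₁ p' = inj₁ (there p')
... | inj₂ (r<q , p' , _) = contradiction p' (Ins-true-no-first-above i r<q)
Ins-second⁻ (skip-first i) (there p) with Ins-second⁻ i p
... | inj₁ p' = inj₁ (there p')
... | inj₂ (r<q , p' , low) = inj₂ (r<q , there p' ,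
        λ { (here refl) x<q → contradiction (At-< p') (<-asym x<q) ; (there u) → low u })

Ins-free⁻ : ∀ {b s s' r q} → Ins b s s' r → At s' q free → At s q free
Ins-free⁻ (place _) (there p) = there p
Ins-free⁻ (bump i) (there p) = there (Ins-free⁻ i p)
Ins-free⁻ (skip-free i) (here e) = here (trans e (sym (Ins-length i)))
Ins-free⁻ (skip-free i) (there p) = there (Ins-free⁻ i p)
Ins-free⁻ (skip-second i) (there p) = there (Ins-free⁻ i p)
Ins-free⁻ (skip-first i) (there p) = there (Ins-free⁻ i p)

-- With such a pair the bumped entry would be at most `x < y` and would have to bump in turn from
-- the second row. No constructor allows this: `skip-second` asks for the index `true`.
Ins-legal : ∀ {b s s' r x y} → Ins b s s' r → r < x → At s x first → x < y → ¬ At s y second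
Ins-legal {true} i r<x p _ _ = Ins-true-no-first-above i r<x p
Ins-legal (bump i) r<x (here refl) x<y (there p') = <-asym x<y (At-< p')
Ins-legal (bump i) r<x (there p) x<y _ = Ins-true-no-first-above i r<x p
Ins-legal {false} (skip-free i) r<x (there p) x<y (there p') = Ins-legal i r<x p x<y p'
Ins-legal (skip-first i) r<x (here refl) x<y (there p') = <-asym x<y (At-< p')
Ins-legal (skip-first i) r<x (there p) x<y (there p') = Ins-legal i r<x p x<y p'

-- The second alternative is the one in which a 321 arises.
insert : ∀ {s r} → At s r free →
  (∃[ b ] ∃[ s' ] Ins b s s' r) ⊎ (∃[ x ] ∃[ y ] r < x × x < y × At s x first × At s y second)
insert (here {s = s} refl) = inj₁ (true , _ , place refl)
insert (there {l} p) with insert p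
insert (there {l} p) | inj₂ (x , y , r<x , x<y , px , py) = inj₂ (x , y , r<x , x<y , there px , there py)
insert (there {free} p) | inj₁ (b , s' , i) = inj₁ (b , _ , skip-free i)
insert (there {first} p) | inj₁ (true , s' , i) = inj₁ (false , _ , bump i)
insert (there {first} p) | inj₁ (false , s' , i) = inj₁ (false , _ , skip-first i)
insert (there {second} p) | inj₁ (true , s' , i) = inj₁ (true , _ , skip-second i)
-- The entry bumped lower down would now have to displace this head. The witnesses are the highest
-- first-row entry and the head.
insert (there {second} p) | inj₁ (false , s' , i) = inj₂ (go i)
  where
  go : ∀ {s s' r} → Ins false s s' r →
    ∃[ x ] ∃[ y ] r < x × x < y × At (second ∷ s) x first × At (second ∷ s) y second
  go (bump {s} i) = length s , suc (length s) , At-< (Ins-free i) , ≤-refl , there (here refl) , here refl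
  go (skip-first {s} i) = length s , suc (length s) , At-< (Ins-free i) , ≤-refl , there (here refl) , here refl
  go (skip-free {s = s} i) with go i
  ... | x , y , r<x , x<y , there px , _ =
        x , suc (length s) , r<x , m≤n⇒m≤1+n (At-< px) , there (there px) , here refl

-- Row lengths, reverse insertion and the ballot condition

Ins-true-firsts : ∀ {s s' r} → Ins true s s' r → firsts s' ≡ suc (firsts s)
Ins-true-firsts (place _) = refl
Ins-true-firsts (skip-free i) = Ins-true-firsts i
Ins-true-firsts (skip-second i) = Ins-true-firsts i

Ins-true-seconds : ∀ {s s' r} → Ins true s s' r → seconds s' ≡ seconds s
Ins-true-seconds (place _) = refl
Ins-true-seconds (skip-free i) = Ins-true-seconds i
Ins-true-seconds (skip-second i) = cong suc (Ins-true-seconds i)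

Ins-false-firsts : ∀ {s s' r} → Ins false s s' r → firsts s' ≡ firsts s
Ins-false-firsts (bump i) = Ins-true-firsts i
Ins-false-firsts (skip-free i) = Ins-false-firsts i
Ins-false-firsts (skip-first i) = cong suc (Ins-false-firsts i)

Ins-false-seconds : ∀ {s s' r} → Ins false s s' r → seconds s' ≡ suc (seconds s)
Ins-false-seconds (bump i) = cong suc (Ins-true-seconds i)
Ins-false-seconds (skip-free i) = Ins-false-seconds i
Ins-false-seconds (skip-first i) = Ins-false-seconds i

-- The index `b` and the head of the resulting state leave only one possible constructor.
Ins-injective : ∀ {b s s' t r r'} → Ins b s s' r → Ins b t s' r' → s ≡ t × r ≡ r'
Ins-injective (place e) (place e') = refl , trans e (sym e')
Ins-injective (bump i) (bump j) = let p , q = Ins-injective i j in cong (first ∷_) p , q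
Ins-injective (skip-free i) (skip-free j) = let p , q = Ins-injective i j in cong (free ∷_) p , q
Ins-injective (skip-second i) (skip-second j) = let p , q = Ins-injective i j in cong (second ∷_) p , q
Ins-injective (skip-first i) (skip-first j) = let p , q = Ins-injective i j in cong (first ∷_) p , q

-- The initial states need not agree in advance: both runs end in `[]`, and equality travels
-- backwards from there.
Run-unique : ∀ {s s' D R R' D₀} → Run s D R D₀ → Run s' D R' D₀ → s ≡ s' × R ≡ R'
Run-unique done done = refl , refl
Run-unique (east i u) (east i' u') with Run-unique u u'
... | refl , refl with Ins-injective i i'
...   | refl , refl = refl , refl
Run-unique (south-first u) (south-first u') with Run-unique u u'
... | refl , refl = refl , refl
Run-unique (south-second u) (south-second u') with Run-unique u u'
... | refl , refl = refl , refl

-- Demanded of every suffix, that is of the restriction to the entries below any bound, this says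
-- that the columns of the tableau increase.
Ballot : List Label → Set
Ballot [] = ⊤
Ballot (l ∷ s) = seconds (l ∷ s) ≤ firsts (l ∷ s) × Ballot s

Ballot-≤ : ∀ s → Ballot s → seconds s ≤ firsts s
Ballot-≤ [] _ = z≤n
Ballot-≤ (l ∷ s) (p , _) = p

Ins-true-Ballot : ∀ {s s' r} → Ins true s s' r → Ballot s → Ballot s'
Ins-true-Ballot (place _) (p , β) = m≤n⇒m≤1+n p , β
Ins-true-Ballot (skip-free i) (p , β) = Ballot-≤ _ (Ins-true-Ballot i β) , Ins-true-Ballot i β
Ins-true-Ballot (skip-second i) (p , β) =
  subst₂ _≤_ (sym (cong suc (Ins-true-seconds i))) (sym (Ins-true-firsts i)) (m≤n⇒m≤1+n p) ,
  Ins-true-Ballot i β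

Ins-false-Ballot : ∀ {s s' r} → Ins false s s' r → Ballot s → Ballot s'
Ins-false-Ballot {first ∷ s} (bump i) (_ , β) =
  subst₂ _≤_ (sym (cong suc (Ins-true-seconds i))) (sym (Ins-true-firsts i)) (s≤s (Ballot-≤ s β)) ,
  Ins-true-Ballot i β
Ins-false-Ballot (skip-free i) (_ , β) = Ballot-≤ _ (Ins-false-Ballot i β) , Ins-false-Ballot i β
Ins-false-Ballot (skip-first i) (_ , β) =
  m≤n⇒m≤1+n (Ballot-≤ _ (Ins-false-Ballot i β)) , Ins-false-Ballot i β

Ins-Ballot : ∀ {b s s' r} → Ins b s s' r → Ballot s → Ballot s'
Ins-Ballot {true} = Ins-true-Ballot
Ins-Ballot {false} = Ins-false-Ballot

-- Expels the largest first-row entry. The bound on `seconds s'` is the slack that keeps the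
-- suffixes containing that entry ballot after the loss.
unplace : ∀ s' {a} → firsts s' ≡ suc a → Ballot s' → seconds s' ≤ a →
  ∃[ s ] ∃[ r ] Ins true s s' r × Ballot s
unplace (free ∷ s') e (_ , β) q =
  let s , r , i , β' = unplace s' e β q in _ , r , skip-free i , (Ballot-≤ s β' , β')
unplace (first ∷ s') refl (_ , β) q = _ , _ , place refl , (q , β)
unplace (second ∷ s') {a} e (_ , β) q =
  let s , r , i , β' = unplace s' e β (<⇒≤ q)
  in _ , r , skip-second i ,
     (subst₂ _≤_ (cong suc (Ins-true-seconds i)) (suc-injective (trans (sym e) (Ins-true-firsts i))) q , β')

-- The largest second-row entry returns to the first row and expels the largest first-row entry
-- below it.
unbump : ∀ s' {c} → seconds s' ≡ suc c → Ballot s' →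
  ∃[ s ] ∃[ r ] Ins false s s' r × Ballot s
unbump (free ∷ s') e (_ , β) =
  let s , r , i , β' = unbump s' e β in _ , r , skip-free i , (Ballot-≤ s β' , β')
unbump (first ∷ s') e (_ , β) =
  let s , r , i , β' = unbump s' e β in _ , r , skip-first i , (m≤n⇒m≤1+n (Ballot-≤ s β') , β')
-- The ballot inequality at this head gives both the first-row entry to expel and the slack that
-- `unplace` requires.
unbump (second ∷ s') e (p , β) = go (firsts s') refl p
  where
  go : ∀ m → firsts s' ≡ m → suc (seconds s') ≤ firsts s' →
    ∃[ s ] ∃[ r ] Ins false s (second ∷ s') r × Ballot s
  go zero e p with subst (suc (seconds s') ≤_) e p
  ... | ()
  go (suc m) e p =
    let s , r , i , β' = unplace s' e β (≤-pred (subst (suc (seconds s') ≤_) e p))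
    in _ , r , bump i , (m≤n⇒m≤1+n (Ballot-≤ s β') , β')

-- Reading a placement along the border

get-++ˡ : ∀ xs {ys c} → c < length xs → get (xs ++ ys) c ≡ get xs c
get-++ˡ (x ∷ xs) {c = zero} _ = refl
get-++ˡ (x ∷ xs) {c = suc c} (s≤s p) = get-++ˡ xs p

get-++ʳ : ∀ xs {ys} c → get (xs ++ ys) (length xs + c) ≡ get ys c
get-++ʳ [] c = refl
get-++ʳ (x ∷ xs) c = get-++ʳ xs c

get-length-++ : ∀ xs {x ys} → get (xs ++ x ∷ ys) (length xs) ≡ x
get-length-++ [] = refl
get-length-++ (y ∷ xs) = get-length-++ xs

<-length-++⁻ : ∀ xs {ys : List ℕ} {c} → c < length (xs ++ ys) →
  c < length xs ⊎ ∃[ c' ] c' < length ys × c ≡ length xs + c'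
<-length-++⁻ [] c< = inj₂ (_ , c< , refl)
<-length-++⁻ (x ∷ xs) {c = zero} _ = inj₁ z<s
<-length-++⁻ (x ∷ xs) {c = suc c} (s≤s p) with <-length-++⁻ xs p
... | inj₁ q = inj₁ (s≤s q)
... | inj₂ (c' , q , e) = inj₂ (c' , q , cong suc e)

<-length-snoc⁻ : ∀ xs {x : ℕ} {c} → c < length (xs ++ x ∷ []) → c < length xs ⊎ c ≡ length xs
<-length-snoc⁻ xs c< with <-length-++⁻ xs c<
... | inj₁ p = inj₁ p
... | inj₂ (zero , _ , e) = inj₂ (trans e (+-identityʳ _))
... | inj₂ (suc _ , s≤s () , _)

<-length-++ˡ : ∀ xs {ys : List ℕ} {c} → c < length xs → c < length (xs ++ ys)
<-length-++ˡ xs {ys} c< = <-≤-trans c< (subst (length xs ≤_) (sym (length-++ xs)) (m≤m+n _ _))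

length-<-++ : ∀ xs {x : ℕ} {ys} → length xs < length (xs ++ x ∷ ys)
length-<-++ [] = z<s
length-<-++ (x ∷ xs) = s≤s (length-<-++ xs)

-- The invariant between a tableau and the word read so far

Occurs : List ℕ → ℕ → Set
Occurs w q = ∃[ c ] c < length w × get w c ≡ q

-- LisOk is required for all suffixes of s, that is for all bounds on the rows, because deletions
-- lower the bound.
LisOk : List Label → List ℕ → Set
LisOk [] w = lis (filter (_<? 0) w) ≡ 0
LisOk (l ∷ s) w = lis (filter (_<? suc (length s)) w) ≡ firsts (l ∷ s) × LisOk s w

LisOk-length : ∀ s {w} → LisOk s w → lis (filter (_<? length s) w) ≡ firsts s
LisOk-length [] e = e
LisOk-length (l ∷ s) (e , _) = e

LisOk-snoc-≥ : ∀ s {w r} → length s ≤ r → LisOk s w → LisOk s (w ++ r ∷ [])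
LisOk-snoc-≥ [] {w} _ e = trans (cong lis (filter-<-snoc-≥ w z≤n)) e
LisOk-snoc-≥ (l ∷ s) {w} p (e , o) =
  trans (cong lis (filter-<-snoc-≥ w p)) e , LisOk-snoc-≥ s (<⇒≤ p) o

-- The index `true` puts `r` beyond the whole first row, so restricting to entries below `r` loses
-- none of it. With the index `false`, treated next, the restriction loses at least the bumped
-- entry.
Ins-true-lis : ∀ {s s' r w} → Ins true s s' r → LisOk s w → lis (filter (_<? r) w) ≡ firsts s
Ins-true-lis {free ∷ s} (place refl) (_ , o) = LisOk-length s o
Ins-true-lis (skip-free i) (_ , o) = Ins-true-lis i o
Ins-true-lis (skip-second i) (_ , o) = Ins-true-lis i o

Ins-false-lis : ∀ {s s' r w} → Ins false s s' r → LisOk s w → lis (filter (_<? r) w) < firsts s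
Ins-false-lis (bump i) (_ , o) = s≤s (≤-reflexive (Ins-true-lis i o))
Ins-false-lis (skip-free i) (_ , o) = Ins-false-lis i o
Ins-false-lis (skip-first i) (_ , o) = m≤n⇒m≤1+n (Ins-false-lis i o)

Ins-LisOk : ∀ {b s s' r w} → Ins b s s' r → LisOk s w → LisOk s' (w ++ r ∷ [])
Ins-LisOk-length : ∀ {b s s' r w} → Ins b s s' r → LisOk s w →
  lis (filter (_<? length s') (w ++ r ∷ [])) ≡ firsts s'
Ins-LisOk-length {b} {s} {s'} {r} {w} i o =
  trans (cong (λ m → lis (filter (_<? m) (w ++ r ∷ []))) (sym (Ins-length i)))
 (trans (lis-filter-snoc w (At-< (Ins-free i)))
 (trans (cong (_⊔ suc (lis (filter (_<? r) w))) (LisOk-length s o)) (go b i)))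
  where
  go : ∀ b → Ins b s s' r → firsts s ⊔ suc (lis (filter (_<? r) w)) ≡ firsts s'
  go true i = trans (cong (λ m → firsts s ⊔ suc m) (Ins-true-lis i o))
                    (trans (m≤n⇒m⊔n≡n (n≤1+n _)) (sym (Ins-true-firsts i)))
  go false i = trans (m≥n⇒m⊔n≡m (Ins-false-lis i o)) (sym (Ins-false-firsts i))
-- The remaining bounds are at most `r` and do not see the new entry.
Ins-LisOk {s = free ∷ s} (place refl) o = Ins-LisOk-length (place refl) o , LisOk-snoc-≥ s ≤-refl (proj₂ o)
Ins-LisOk (bump i) o = Ins-LisOk-length (bump i) o , Ins-LisOk i (proj₂ o)
Ins-LisOk (skip-free i) o = Ins-LisOk-length (skip-free i) o , Ins-LisOk i (proj₂ o)
Ins-LisOk (skip-second i) o = Ins-LisOk-length (skip-second i) o , Ins-LisOk i (proj₂ o)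
Ins-LisOk (skip-first i) o = Ins-LisOk-length (skip-first i) o , Ins-LisOk i (proj₂ o)

-- s is the insertion tableau of the entries of w below length s. By Ins-legal, inverted shows that
-- insertions preserve no321; conversely descent turns a failing insertion into a 321.
record Inv (s : List Label) (w : List ℕ) : Set where
  field
    lis-ok   : LisOk s w
    absent   : ∀ {q} → At s q free → ¬ Occurs w q
    present  : ∀ {q k} → At s q k → k ≢ free → Occurs w q
    inverted : ∀ {c₁ c₂} → c₁ < c₂ → c₂ < length w →
      get w c₁ < length s → get w c₂ < get w c₁ →
      ∃[ y ] ∃[ x ] At s y second × At s x first × get w c₂ ≤ x × x < y × y ≤ get w c₁
    descent  : ∀ {y x} → At s y second → At s x first → x < y →
      ∃[ c₁ ] ∃[ c₂ ] c₁ < c₂ × c₂ < length w × get w c₂ < get w c₁ × x ≤ get w c₂ × get w c₁ ≤ y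
    no321    : ∀ {c₁ c₂ c₃} → c₁ < c₂ → c₂ < c₃ → c₃ < length w →
      get w c₁ < length s → get w c₂ < get w c₁ → ¬ get w c₃ < get w c₂

open Inv

Inv-drop : ∀ {l s w} → Inv (l ∷ s) w → Inv s w
Inv-drop v .lis-ok = proj₂ (v .lis-ok)
Inv-drop v .absent p = v .absent (there p)
Inv-drop v .present p = v .present (there p)
-- The deleted row is neither witness: `y` is at most an entry below the lowered bound, and `x < y`.
Inv-drop v .inverted c< c₂< g< d with v .inverted c< c₂< (m≤n⇒m≤1+n g<) d
... | y , x , here refl , _ , _ , _ , y≤ = contradiction y≤ (<⇒≱ g<)
... | y , x , there py , here refl , _ , x<y , y≤ = contradiction (At-< py) (<-asym x<y)
... | y , x , there py , there px , rest = y , x , py , px , rest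
Inv-drop v .descent py px = v .descent (there py) (there px)
Inv-drop v .no321 a b c g< = v .no321 a b c (m≤n⇒m≤1+n g<)

Inv-snoc : ∀ {b s s' r w} → Ins b s s' r → Inv s w → Inv s' (w ++ r ∷ [])
Inv-snoc {b} {s} {s'} {r} {w} i v = record
  { lis-ok = Ins-LisOk i (v .lis-ok)
  ; absent = absent'
  ; present = present'
  ; inverted = inverted'
  ; descent = descent'
  ; no321 = no321'
  }
  where
  W = w ++ r ∷ []
  old : ∀ {c} → c < length w → get W c ≡ get w c
  old = get-++ˡ w
  new : get W (length w) ≡ r
  new = get-length-++ w
  ext : ∀ {q} → Occurs w q → Occurs W q
  ext (c , c< , e) = c , <-length-++ˡ w c< , trans (old c<) e
  len : ∀ {q} → q < length s' → q < length s
  len = subst (_ <_) (sym (Ins-length i))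
  absent' : ∀ {q} → At s' q free → ¬ Occurs W q
  absent' p (c , c< , e) with <-length-snoc⁻ w c<
  ... | inj₁ c<' = v .absent (Ins-free⁻ i p) (c , c<' , trans (sym (old c<')) e)
  ... | inj₂ refl with trans (sym new) e
  ...   | refl with At-unique p (Ins-first i)
  ...     | ()
  present' : ∀ {q k} → At s' q k → k ≢ free → Occurs W q
  present' {k = free} _ k≢ = contradiction refl k≢
  present' {k = first} p _ with Ins-first⁻ i p
  ... | inj₁ refl = length w , length-<-++ w , new
  ... | inj₂ p' = ext (v .present p' λ ())
  present' {k = second} p _ with Ins-second⁻ i p
  ... | inj₁ p' = ext (v .present p' λ ())
  ... | inj₂ (_ , p' , _) = ext (v .present p' λ ())
  inverted' : ∀ {c₁ c₂} → c₁ < c₂ → c₂ < length W → get W c₁ < length s' → get W c₂ < get W c₁ →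
    ∃[ y ] ∃[ x ] At s' y second × At s' x first × get W c₂ ≤ x × x < y × y ≤ get W c₁
  inverted' {c₁} {c₂} c< c₂< g< d with <-length-snoc⁻ w c₂<
  ... | inj₁ c₂<' rewrite old c₂<' | old (<-trans c< c₂<') =
        let y , x , py , px , ≤x , x<y , y≤ = v .inverted c< c₂<' (len g<) d
        in y , x , Ins-keeps-second i py , Ins-keeps-first i px py x<y , ≤x , x<y , y≤
  -- For an inversion ending in the new rook, `r` serves as `x`. The larger entry serves as `y` if
  -- it is in the second row; otherwise the bumped entry does.
  ... | inj₂ refl rewrite old c< | new with At-total s (len g<)
  ...   | free , p = contradiction (c₁ , c< , refl) (v .absent p)
  ...   | second , p = get w c₁ , r , Ins-keeps-second i p , Ins-first i , ≤-refl , d , ≤-refl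
  ...   | first , p = let a , r<a , a≤ , pa = Ins-second-above i d p
                      in a , r , pa , Ins-first i , ≤-refl , r<a , a≤
  with-new : ∀ {y x} → Occurs w y → r < y → x ≤ r →
    ∃[ c₁ ] ∃[ c₂ ] c₁ < c₂ × c₂ < length W × get W c₂ < get W c₁ × x ≤ get W c₂ × get W c₁ ≤ y
  with-new (c , c< , refl) r<y x≤r =
    c , length w , c< , length-<-++ w ,
    subst₂ _<_ (sym new) (sym (old c<)) r<y , subst (_ ≤_) (sym new) x≤r , ≤-reflexive (old c<)
  descent' : ∀ {y x} → At s' y second → At s' x first → x < y →
    ∃[ c₁ ] ∃[ c₂ ] c₁ < c₂ × c₂ < length W × get W c₂ < get W c₁ × x ≤ get W c₂ × get W c₁ ≤ y
  descent' {y} {x} py px x<y with Ins-second⁻ i py | Ins-first⁻ i px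
  ... | inj₁ py' | inj₂ px' with v .descent py' px' x<y
  ...   | c₁ , c₂ , c< , c₂< , d , x≤ , ≤y
          rewrite sym (old c₂<) | sym (old (<-trans c< c₂<)) =
          c₁ , c₂ , c< , <-length-++ˡ w c₂< , d , x≤ , ≤y
  descent' {y} {x} py px x<y | inj₁ py' | inj₁ refl =
    with-new (v .present py' λ ()) x<y ≤-refl
  -- Here `y` has just been bumped. By its minimality every smaller first-row entry is at most `r`,
  -- so the descent may end in the new rook.
  descent' {y} {x} py px x<y | inj₂ (r<y , py' , low) | px⁻ =
    with-new (v .present py' λ ()) r<y (le px⁻)
    where
    le : x ≡ r ⊎ At s x first → x ≤ r
    le (inj₁ refl) = ≤-refl
    le (inj₂ px') = low px' x<y
  no321' : ∀ {c₁ c₂ c₃} → c₁ < c₂ → c₂ < c₃ → c₃ < length W →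
    get W c₁ < length s' → get W c₂ < get W c₁ → ¬ get W c₃ < get W c₂
  no321' {c₁} {c₂} {c₃} c< c<' c₃< g< d d' with <-length-snoc⁻ w c₃<
  ... | inj₁ p rewrite old p | old (<-trans c<' p) | old (<-trans c< (<-trans c<' p)) =
        v .no321 c< c<' p (len g<) d d'
  -- The older descent yields a first-row entry above `r` and a second-row entry above that, where
  -- this insertion would have failed.
  ... | inj₂ refl rewrite new | old c<' | old (<-trans c< c<') =
        let y , x , py , px , ≤x , x<y , _ = v .inverted c< c<' (len g<) d
        in Ins-legal i (<-≤-trans d' ≤x) px x<y py

At-replicate : ∀ n {q k} → At (replicate n free) q k → k ≡ free
At-replicate (suc n) (here _) = refl
At-replicate (suc n) (there p) = At-replicate n p

Ballot-replicate : ∀ n → Ballot (replicate n free)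
Ballot-replicate zero = tt
Ballot-replicate (suc n) = Ballot-≤ _ (Ballot-replicate n) , Ballot-replicate n

firsts-replicate : ∀ n → firsts (replicate n free) ≡ 0
firsts-replicate zero = refl
firsts-replicate (suc n) = firsts-replicate n

seconds-replicate : ∀ n → seconds (replicate n free) ≡ 0
seconds-replicate zero = refl
seconds-replicate (suc n) = seconds-replicate n

no-labels⇒replicate : ∀ s → firsts s ≡ 0 → seconds s ≡ 0 → s ≡ replicate (length s) free
no-labels⇒replicate [] _ _ = refl
no-labels⇒replicate (free ∷ s) e e' = cong (free ∷_) (no-labels⇒replicate s e e')

Inv-replicate : ∀ n → Inv (replicate n free) []
Inv-replicate n = record
  { lis-ok = ok n
  ; absent = λ { _ (_ , () , _) }
  ; present = λ p k≢ → contradiction (At-replicate n p) k≢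
  ; inverted = λ _ ()
  ; descent = λ p → contradiction (At-replicate n p) λ ()
  ; no321 = λ _ _ ()
  }
  where
  ok : ∀ n → LisOk (replicate n free) []
  ok zero = refl
  ok (suc n) = sym (firsts-replicate n) , ok n

-- Written without subtraction, `height` says that the sum of the row lengths follows the height of
-- `D`, and `height₀` that their difference follows the height of `D₀`.
record Vertex (s : List Label) (D : List Bool) (w : List ℕ) (D₀ : List Bool) (i : ℕ) : Set where
  field
    state   : List Label
    inv     : Inv state w
    ballot  : Ballot state
    top     : length state ≡ length s ∸ sc D i
    height  : firsts s + seconds s + ec D i ≡ firsts state + seconds state + sc D i
    height₀ : firsts s + ec D₀ i + seconds state ≡ firsts state + seconds s + sc D₀ i

open Vertex

Run-vertex : ∀ {s D R D₀ w i} → Run s D R D₀ → Inv s w → Ballot s → i ≤ length D →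
  Vertex s D (w ++ take (ec D i) R) D₀ i
Run-vertex {s} {R = R} {w = w} {i = zero} u v β _ = record
  { state = s
  ; inv = subst (Inv s) (sym (++-identityʳ w)) v
  ; ballot = β
  ; top = refl
  ; height = refl
  ; height₀ = sym (trans (+-identityʳ _) (cong (_+ seconds s) (sym (+-identityʳ _))))
  }
Run-vertex {w = w} {i = suc i} (east {true} {s} {r = r} {D} {R} ins u) v β (s≤s i≤)
  with Run-vertex u (Inv-snoc ins v) (Ins-Ballot ins β) i≤
... | x with height x | height₀ x
...   | h | h₀ rewrite Ins-true-firsts ins | Ins-true-seconds ins = record
  { state = state x
  ; inv = subst (Inv (state x)) (++-assoc w (r ∷ []) (take (ec D i) R)) (inv x)
  ; ballot = ballot x
  ; top = trans (top x) (cong (_∸ sc D i) (sym (Ins-length ins)))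
  ; height = trans (+-suc _ _) h
  ; height₀ = trans (cong (_+ seconds (state x)) (+-suc (firsts s) _)) h₀
  }
Run-vertex {w = w} {i = suc i} (east {false} {s} {r = r} {D} {R} {D₀} ins u) v β (s≤s i≤)
  with Run-vertex u (Inv-snoc ins v) (Ins-Ballot ins β) i≤
... | x with height x | height₀ x
...   | h | h₀ rewrite Ins-false-firsts ins | Ins-false-seconds ins = record
  { state = state x
  ; inv = subst (Inv (state x)) (++-assoc w (r ∷ []) (take (ec D i) R)) (inv x)
  ; ballot = ballot x
  ; top = trans (top x) (cong (_∸ sc D i) (sym (Ins-length ins)))
  ; height = trans (+-suc _ _) (trans (cong (_+ ec D i) (sym (+-suc (firsts s) _))) h)
  ; height₀ = trans h₀ (trans (cong (_+ sc D₀ i) (+-suc (firsts (state x)) _)) (sym (+-suc _ _)))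
  }
Run-vertex {i = suc i} (south-first u) v (_ , β) (s≤s i≤) =
  let x = Run-vertex u (Inv-drop v) β i≤ in record
  { state = state x
  ; inv = inv x
  ; ballot = ballot x
  ; top = top x
  ; height = trans (cong suc (height x)) (sym (+-suc _ _))
  ; height₀ = trans (cong suc (height₀ x)) (sym (+-suc _ _))
  }
Run-vertex {i = suc i} (south-second {s} {D} {R} {D₀} u) v (_ , β) (s≤s i≤) =
  let x = Run-vertex u (Inv-drop v) β i≤ in record
  { state = state x
  ; inv = inv x
  ; ballot = ballot x
  ; top = top x
  ; height = trans (cong (_+ ec D i) (+-suc (firsts s) _)) (trans (cong suc (height x)) (sym (+-suc _ _)))
  ; height₀ = trans (cong (_+ seconds (state x)) (+-suc (firsts s) _))
             (trans (cong suc (height₀ x)) (cong (_+ sc D₀ i) (sym (+-suc (firsts (state x)) _))))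
  }

-- From runs to full placements, and back

Run-length-columns : ∀ {s D R D₀} → Run s D R D₀ → length R ≡ ec D (length D)
Run-length-columns done = refl
Run-length-columns (east _ u) = cong suc (Run-length-columns u)
Run-length-columns (south-first u) = Run-length-columns u
Run-length-columns (south-second u) = Run-length-columns u

Run-length-rows : ∀ {s D R D₀} → Run s D R D₀ → length s ≡ sc D (length D)
Run-length-rows done = refl
Run-length-rows (east i u) = trans (Ins-length i) (Run-length-rows u)
Run-length-rows (south-first u) = cong suc (Run-length-rows u)
Run-length-rows (south-second u) = cong suc (Run-length-rows u)

Run-length-paths : ∀ {s D R D₀} → Run s D R D₀ → length D₀ ≡ length D
Run-length-paths done = refl
Run-length-paths (east _ u) = cong suc (Run-length-paths u)
Run-length-paths (south-first u) = cong suc (Run-length-paths u)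
Run-length-paths (south-second u) = cong suc (Run-length-paths u)

RookUnder : List Bool → ℕ → ℕ → ℕ → Set
RookUnder D y c r = ∃[ i ] i < length D × getB D i ≡ true × ec D i ≡ c × r < y ∸ sc D i

Run-under : ∀ {s D R D₀ c} → Run s D R D₀ → c < length R → RookUnder D (length s) c (get R c)
Run-under {c = zero} (east i u) _ = 0 , z<s , refl , refl , At-< (Ins-free i)
Run-under {D = true ∷ D} {R = r ∷ R} {c = suc c} (east i u) (s≤s c<) =
  let j , j< , g , e , p = Run-under u c<
  in suc j , s≤s j< , g , cong suc e , subst (λ m → get R c < m ∸ sc D j) (sym (Ins-length i)) p
Run-under (south-first u) c< =
  let j , j< , g , e , p = Run-under u c< in suc j , s≤s j< , g , e , p
Run-under (south-second u) c< =
  let j , j< , g , e , p = Run-under u c< in suc j , s≤s j< , g , e , p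

Ins-free⁺ : ∀ {b s s' r q} → Ins b s s' r → At s q free → q ≡ r ⊎ At s' q free
Ins-free⁺ {s' = s'} {q = q} i p with At-total s' (subst (q <_) (Ins-length i) (At-< p))
... | free , p' = inj₂ p'
... | first , p' with Ins-first⁻ i p'
...   | inj₁ e = inj₁ e
...   | inj₂ p″ with At-unique p p″
...     | ()
Ins-free⁺ i p | second , p' with Ins-second⁻ i p'
... | inj₁ p″ with At-unique p p″
...   | ()
Ins-free⁺ i p | second , p' | inj₂ (_ , p″ , _) with At-unique p p″
... | ()

-- A run ends without rows, and a south step removes only a labelled row, so each free row receives
-- a rook on the way.
Run-covers : ∀ {s D R D₀ q} → Run s D R D₀ → At s q free → Occurs R q
Run-covers (east i u) p with Ins-free⁺ i p
... | inj₁ refl = 0 , z<s , refl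
... | inj₂ p' = let c , c< , e = Run-covers u p' in suc c , s≤s c< , e
Run-covers (south-first u) (there p) = Run-covers u p
Run-covers (south-second u) (there p) = Run-covers u p

Run-free : ∀ {s D R D₀ c} → Run s D R D₀ → c < length R → At s (get R c) free
Run-free {c = zero} (east i u) _ = Ins-free i
Run-free {c = suc c} (east i u) (s≤s c<) = Ins-free⁻ i (Run-free u c<)
Run-free (south-first u) c< = there (Run-free u c<)
Run-free (south-second u) c< = there (Run-free u c<)

-- Once read, the row of a rook is labelled `first`, whereas all later rooks lie in rows that are
-- still free.
Run-distinct : ∀ {s D R D₀ c c'} → Run s D R D₀ → c < length R → c' < length R →
  get R c ≡ get R c' → c ≡ c'
Run-distinct {c = zero} {zero} (east i u) _ _ _ = refl
Run-distinct {c = zero} {suc c'} (east i u) _ (s≤s c'<) refl with At-unique (Run-free u c'<) (Ins-first i)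
... | ()
Run-distinct {c = suc c} {zero} (east i u) (s≤s c<) _ refl with At-unique (Run-free u c<) (Ins-first i)
... | ()
Run-distinct {c = suc c} {suc c'} (east i u) (s≤s c<) (s≤s c'<) e = cong suc (Run-distinct u c< c'< e)
Run-distinct (south-first u) = Run-distinct u
Run-distinct (south-second u) = Run-distinct u

-- R are the rows of the columns still to be read after w, along the rest D of the border.
record Extends (s : List Label) (D : List Bool) (w R : List ℕ) : Set where
  field
    inv      : Inv s w
    columns  : length R ≡ ec D (length D)
    rows     : length s ≡ sc D (length D)
    under    : ∀ {c} → c < length R → RookUnder D (length s) c (get R c)
    covers   : ∀ {q} → q < length s → Occurs (w ++ R) q
    distinct : ∀ {c c'} → c < length (w ++ R) → c' < length (w ++ R) →
               get (w ++ R) c ≡ get (w ++ R) c' → c ≡ c'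
    avoids   : ∀ {i c₁ c₂ c₃} → i ≤ length D → c₁ < c₂ → c₂ < c₃ → c₃ < length w + ec D i →
               get (w ++ R) c₁ < length s ∸ sc D i → get (w ++ R) c₂ < get (w ++ R) c₁ →
               ¬ get (w ++ R) c₃ < get (w ++ R) c₂

module E = Extends

-- Fullness lets each south step find an entry to delete; avoidance lets each insertion succeed.
Extends-run : ∀ {s D w R} → Extends s D w R → ∃[ D₀ ] Run s D R D₀
Extends-run {[]} {[]} {R = []} x = [] , done
Extends-run {l ∷ s} {[]} x with E.rows x
... | ()
Extends-run {D = []} {R = r ∷ R} x with E.columns x
... | ()
Extends-run {[]} {false ∷ D} x with E.rows x
... | ()
Extends-run {l ∷ s} {false ∷ D} {w} {R} x = go l x (Extends-run tail)
  where
  under' : ∀ {c} → c < length R → RookUnder D (length s) c (get R c)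
  under' c< with E.under x c<
  ... | zero , _ , () , _
  ... | suc i , s≤s i< , g , e , p = i , i< , g , e , p
  tail : Extends s D w R
  tail = record
    { inv = Inv-drop (E.inv x)
    ; columns = E.columns x
    ; rows = suc-injective (E.rows x)
    ; under = under'
    ; covers = λ q< → E.covers x (m≤n⇒m≤1+n q<)
    ; distinct = E.distinct x
    ; avoids = λ i≤ → E.avoids x (s≤s i≤)
    }
  go : ∀ l → Extends (l ∷ s) (false ∷ D) w R → ∃[ D₀ ] Run s D R D₀ →
    ∃[ D₀ ] Run (l ∷ s) (false ∷ D) R D₀
  go first _ (D₀ , u) = _ , south-first u
  go second _ (D₀ , u) = _ , south-second u
  -- A free top row would have its rook neither in `w`, by `absent`, nor in `R`, whose columns all
  -- end below that row.
  go free x _ with E.covers x {length s} ≤-refl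
  ... | c , c< , e with <-length-++⁻ w c<
  ...   | inj₁ c<w = contradiction (c , c<w , trans (sym (get-++ˡ w c<w)) e) (absent (E.inv x) (here refl))
  ...   | inj₂ (c' , c'< , refl) with under' c'<
  ...     | i , _ , _ , _ , p =
            contradiction (≤-trans p (m∸n≤m (length s) (sc D i)))
                          (<-irrefl (trans (sym (get-++ʳ w c')) e))
Extends-run {s} {true ∷ D} {w} {[]} x with E.columns x
... | ()
Extends-run {s} {true ∷ D} {w} {r ∷ R} x = go (At-total s r<)
  where
  r< : r < length s
  r< with E.under x {0} z<s
  ... | zero , _ , _ , _ , p = p
  ... | suc i , _ , _ , () , _
  assoc : (w ++ r ∷ []) ++ R ≡ w ++ r ∷ R
  assoc = ++-assoc w (r ∷ []) R
  tail : ∀ {b s'} → Ins b s s' r → Extends s' D (w ++ r ∷ []) R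
  tail {s' = s'} i = record
    { inv = Inv-snoc i (E.inv x)
    ; columns = suc-injective (E.columns x)
    ; rows = trans (sym (Ins-length i)) (E.rows x)
    ; under = under'
    ; covers = subst (λ z → ∀ {q} → q < length s' → Occurs z q) (sym assoc)
                 (λ q< → E.covers x (subst (_ <_) (sym (Ins-length i)) q<))
    ; distinct = subst (λ z → ∀ {c c'} → c < length z → c' < length z → get z c ≡ get z c' → c ≡ c')
                   (sym assoc) (E.distinct x)
    ; avoids = subst (λ z → ∀ {j c₁ c₂ c₃} → j ≤ length D → c₁ < c₂ → c₂ < c₃ →
                   c₃ < length (w ++ r ∷ []) + ec D j → get z c₁ < length s' ∸ sc D j →
                   get z c₂ < get z c₁ → ¬ get z c₃ < get z c₂) (sym assoc) avoids'
    }
    where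
    under' : ∀ {c} → c < length R → RookUnder D (length s') c (get R c)
    under' {c} c< with E.under x (s≤s c<)
    ... | suc j , s≤s j< , g , e , p =
          j , j< , g , suc-injective e , subst (λ m → get R c < m ∸ sc D j) (Ins-length i) p
    avoids' : ∀ {j c₁ c₂ c₃} → j ≤ length D → c₁ < c₂ → c₂ < c₃ →
      c₃ < length (w ++ r ∷ []) + ec D j → get (w ++ r ∷ R) c₁ < length s' ∸ sc D j →
      get (w ++ r ∷ R) c₂ < get (w ++ r ∷ R) c₁ → ¬ get (w ++ r ∷ R) c₃ < get (w ++ r ∷ R) c₂
    avoids' {j} {c₁} {c₃ = c₃} j≤ c< c<' c₃< g< = E.avoids x (s≤s j≤) c< c<'
      (subst (c₃ <_) (trans (cong (_+ ec D j) (length-++ w)) (+-assoc (length w) 1 _)) c₃<)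
      (subst (λ m → get (w ++ r ∷ R) c₁ < m ∸ sc D j) (sym (Ins-length i)) g<)
  not-occurs : ¬ Occurs w r
  not-occurs (c , c< , e) =
    <-irrefl (E.distinct x (<-length-++ˡ w c<) (length-<-++ w)
               (trans (get-++ˡ w c<) (trans e (sym (get-length-++ w))))) c<
  go : (∃[ k ] At s r k) → ∃[ D₀ ] Run s (true ∷ D) (r ∷ R) D₀
  go (first , p) = contradiction (present (E.inv x) p λ ()) not-occurs
  go (second , p) = contradiction (present (E.inv x) p λ ()) not-occurs
  go (free , p) with insert p
  ... | inj₁ (b , s' , i) = let D₀ , u = Extends-run (tail i) in b ∷ D₀ , east i u
  ... | inj₂ (a , y , r<a , a<y , pa , py) with descent (E.inv x) py pa a<y
  ...   | c₁ , c₂ , c< , c₂< , d , a≤ , ≤y = ⊥-elim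
          -- Index 1 is the vertex right after this east step: it sees `w` and `r`, and the bound is
          -- still `length s`.
          (E.avoids x {1} (s≤s z≤n) c< c₂< (subst (length w <_) (+-comm 1 _) ≤-refl)
            (subst (_< length s) (sym o₁) (≤-<-trans ≤y (At-< py)))
            (subst₂ _<_ (sym o₂) (sym o₁) d)
            (subst₂ _<_ (sym (get-length-++ w)) (sym o₂) (<-≤-trans r<a a≤)))
    where
    o₁ = get-++ˡ w {r ∷ R} (<-trans c< c₂<)
    o₂ = get-++ˡ w {r ∷ R} c₂<

-- Placements and pairs of Dyck paths

difference-difference : ∀ a b c d → + (c + b) - + (a + d) ≡ (+ c - + d) - (+ a - + b)
difference-difference a b c d = go (+ a) (+ b) (+ c) (+ d)
  where
  go : ∀ a b c d → (c ℤ.+ b) - (a ℤ.+ d) ≡ (c - d) - (a - b)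
  go = ℤ-Solver.solve-∀

difference-≤⁺ : ∀ a b c d → a + d ≤ c + b → + a - + b ℤ.≤ + c - + d
difference-≤⁺ a b c d p = ℤₚ.0≤i-j⇒j≤i
  (subst (+ 0 ℤ.≤_) (difference-difference a b c d) (ℤₚ.i≤j⇒0≤j-i (ℤ.+≤+ p)))

difference-≤⁻ : ∀ a b c d → + a - + b ℤ.≤ + c - + d → a + d ≤ c + b
difference-≤⁻ a b c d p = ℤₚ.drop‿+≤+ (ℤₚ.0≤i-j⇒j≤i
  (subst (+ 0 ℤ.≤_) (sym (difference-difference a b c d)) (ℤₚ.i≤j⇒0≤j-i p)))

difference-≡⁺ : ∀ a b c d → a + d ≡ c + b → + a - + b ≡ + c - + d
difference-≡⁺ a b c d e =
  ℤₚ.≤-antisym (difference-≤⁺ a b c d (≤-reflexive e)) (difference-≤⁺ c d a b (≤-reflexive (sym e)))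

ec+sc≡ : ∀ D {i} → i ≤ length D → ec D i + sc D i ≡ i
ec+sc≡ D {zero} _ = refl
ec+sc≡ (true ∷ D) {suc i} (s≤s p) = cong suc (ec+sc≡ D p)
ec+sc≡ (false ∷ D) {suc i} (s≤s p) = trans (+-suc _ _) (cong suc (ec+sc≡ D p))

Dyck-counts : ∀ n D → Dyck n D → ec D (2 * n) ≡ n × sc D (2 * n) ≡ n
Dyck-counts n D (len , _ , end) = e≡n , trans (sym e≡s) e≡n
  where
  e≡s : ec D (2 * n) ≡ sc D (2 * n)
  e≡s = ℤₚ.+-injective (ℤₚ.i-j≡0⇒i≡j _ _ end)
  e≡n : ec D (2 * n) ≡ n
  e≡n = *-cancelˡ-≡ _ n 2 (trans (cong (λ m → ec D (2 * n) + m) (trans (+-identityʳ _) e≡s))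
          (ec+sc≡ D (≤-reflexive (sym len))))

sc≤ec : ∀ n D {i} → Dyck n D → i ≤ 2 * n → sc D i ≤ ec D i
sc≤ec n D {i} (_ , nonneg , _) i≤ = ℤₚ.drop‿+≤+ (ℤₚ.0≤i-j⇒j≤i (nonneg i i≤))

Dyck-head : ∀ n D → 0 < n → Dyck n D → getB D 0 ≡ true
Dyck-head (suc n) (true ∷ D) _ _ = refl
Dyck-head (suc n) (false ∷ D) _ δ with sc≤ec (suc n) (false ∷ D) {1} δ (s≤s z≤n)
... | ()

-- Here `a` and `b` are the row lengths wanted at the start. They and the two paths fix the row
-- lengths at every later vertex: the first bound keeps the second row no longer than the first, and
-- the other says that twice the length of the second row is nonnegative. The later states are built
-- before the earlier ones.
Run-exists : ∀ D D₀ a b → length D₀ ≡ length D →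
  (∀ {i} → i ≤ length D → b + sc D₀ i ≤ a + ec D₀ i) →
  (∀ {i} → i ≤ length D → sc D i + ec D₀ i ≤ b + b + ec D i + sc D₀ i) →
  a + ec D₀ (length D) ≡ b + sc D₀ (length D) →
  a + b + ec D (length D) ≡ sc D (length D) →
  ∃[ s ] ∃[ R ] Run s D R D₀ × firsts s ≡ a × seconds s ≡ b × Ballot s
Run-exists [] [] zero b len low high end₀ end =
  [] , [] , done , refl , sym (m+n≡0⇒m≡0 b end) , tt
Run-exists (true ∷ D) (true ∷ D₀) a b len low high end₀ end
  with Run-exists D D₀ (suc a) b (suc-injective len)
         (λ {i} i≤ → subst (b + sc D₀ i ≤_) (+-suc a _) (low (s≤s i≤)))
         (λ {i} i≤ → ≤-pred (subst₂ _≤_ (+-suc _ _) (cong (_+ sc D₀ i) (+-suc (b + b) _)) (high (s≤s i≤))))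
         (trans (sym (+-suc a _)) end₀)
         (trans (sym (+-suc (a + b) _)) end)
... | s' , R , u , f , t , β
  with unplace s' f β (subst₂ _≤_ (trans (+-identityʳ b) (sym t)) (+-identityʳ a) (low z≤n))
...   | s , r , i , β' = s , _ , east i u , suc-injective (trans (sym (Ins-true-firsts i)) f) ,
                        trans (sym (Ins-true-seconds i)) t , β'
Run-exists (true ∷ D) (false ∷ D₀) a b len low high end₀ end
  with Run-exists D D₀ a (suc b) (suc-injective len)
         (λ {i} i≤ → subst (_≤ a + ec D₀ i) (+-suc b _) (low (s≤s i≤)))
         (λ {i} i≤ → subst (sc D i + ec D₀ i ≤_) (high-eq b (ec D i) (sc D₀ i)) (high (s≤s i≤)))
         (trans end₀ (+-suc b _))
         (trans (trans (cong (_+ ec D (length D)) (+-suc a b)) (sym (+-suc (a + b) _))) end)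
  where
  high-eq : ∀ b e s → b + b + suc e + suc s ≡ suc b + suc b + e + s
  high-eq b e s = trans (+-suc _ s) (cong (λ m → suc (m + s))
    (trans (+-suc (b + b) e) (cong (_+ e) (sym (+-suc b b)))))
... | s' , R , u , f , t , β with unbump s' t β
...   | s , r , i , β' = s , _ , east i u , trans (sym (Ins-false-firsts i)) f ,
                        suc-injective (trans (sym (Ins-false-seconds i)) t) , β'
-- A deletion from an empty first row is excluded by `low` at the next vertex.
Run-exists (false ∷ D) (false ∷ D₀) zero b len low high end₀ end
  with trans (+-comm 1 b) (n≤0⇒n≡0 (low {1} (s≤s z≤n)))
... | ()
Run-exists (false ∷ D) (false ∷ D₀) (suc a) b len low high end₀ end
  with Run-exists D D₀ a b (suc-injective len)
         (λ {i} i≤ → ≤-pred (subst (_≤ suc a + ec D₀ i) (+-suc b _) (low (s≤s i≤))))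
         (λ {i} i≤ → ≤-pred (subst (suc (sc D i) + ec D₀ i ≤_) (+-suc (b + b + ec D i) _) (high (s≤s i≤))))
         (suc-injective (trans end₀ (+-suc b _)))
         (suc-injective end)
... | s , R , u , f , t , β =
      first ∷ s , R , south-first u , cong suc f , t ,
      (subst₂ _≤_ (trans (+-identityʳ b) (sym t)) (trans (+-identityʳ _) (cong suc (sym f))) (low z≤n) , β)
-- Likewise `high` excludes a deletion from an empty second row.
Run-exists (false ∷ D) (true ∷ D₀) a zero len low high end₀ end with high {1} (s≤s z≤n)
... | ()
Run-exists (false ∷ D) (true ∷ D₀) a (suc b) len low high end₀ end
  with Run-exists D D₀ a b (suc-injective len)
         (λ {i} i≤ → ≤-pred (subst (suc b + sc D₀ i ≤_) (+-suc a _) (low (s≤s i≤))))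
         (λ {i} i≤ → ≤-pred (≤-pred (subst₂ _≤_ (cong suc (+-suc _ _)) (cong (λ m → suc m + ec D i + sc D₀ i) (+-suc b b)) (high (s≤s i≤)))))
         (suc-injective (trans (sym (+-suc a _)) end₀))
         (suc-injective (trans (cong (_+ ec D (length D)) (sym (+-suc a b))) end))
... | s , R , u , f , t , β =
      second ∷ s , R , south-second u , f , cong suc t ,
      (subst₂ _≤_ (trans (+-identityʳ _) (cong suc (sym t))) (trans (+-identityʳ _) (sym f)) (low z≤n) , β)

get-take : ∀ k xs {c} → c < k → get (take k xs) c ≡ get xs c
get-take (suc k) [] _ = refl
get-take (suc k) (x ∷ xs) {zero} _ = refl
get-take (suc k) (x ∷ xs) {suc c} (s≤s p) = get-take k xs p

ec-mono-≤ : ∀ D {i j} → i ≤ j → ec D i ≤ ec D j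
ec-mono-≤ D z≤n = z≤n
ec-mono-≤ [] (s≤s p) = z≤n
ec-mono-≤ (true ∷ D) (s≤s p) = s≤s (ec-mono-≤ D p)
ec-mono-≤ (false ∷ D) (s≤s p) = ec-mono-≤ D p

InF⇒< : ∀ n D {c r} → InF n D c r → r < n
InF⇒< n D (i , _ , _ , _ , r<) = <-≤-trans r< (m∸n≤m n (sc D i))

FullRook-injective : ∀ n D R {c c'} → FullRook n D R → c < n → c' < n → get R c ≡ get R c' → c ≡ c'
FullRook-injective n D R {c} {c'} (_ , inF , row) c< c'< e =
  proj₂ (row (get R c) (c , inF c c<)) c c' c< c'< refl (sym e)


module _ {n : ℕ} {D : List Bool} (δ : Dyck n D) where

  private
    len : length D ≡ 2 * n
    len = proj₁ δ

    into : ∀ {i} → i ≤ length D → i ≤ 2 * n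
    into = subst (_ ≤_) len

    out : ∀ {i} → i ≤ 2 * n → i ≤ length D
    out = subst (_ ≤_) (sym len)

    ec-length : ec D (length D) ≡ n
    ec-length = trans (cong (ec D) len) (proj₁ (Dyck-counts n D δ))

    sc-length : sc D (length D) ≡ n
    sc-length = trans (cong (sc D) len) (proj₂ (Dyck-counts n D δ))

  -- As the border starts with an east step, column 0 meets all `n` rows, so the row condition of
  -- `FullRook` reaches each of them.
  row-nonempty : ∀ {r} → r < n → InF n D 0 r
  row-nonempty r<n =
    0 , <-≤-trans (≤-<-trans z≤n r<n) (m≤m+n n _) , Dyck-head n D (≤-<-trans z≤n r<n) δ , refl , r<n

  R321⇒Run : ∀ {R} → R321 n D R → ∃[ D₀ ] Run (replicate n free) D R D₀
  R321⇒Run {R} (full@(lenR , inF , row) , avoid) = Extends-run (record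
    { inv = Inv-replicate n
    ; columns = trans lenR (sym ec-length)
    ; rows = trans (length-replicate n) (sym sc-length)
    ; under = λ {c} c< → let i , i< , g , e , p = inF c (subst (c <_) lenR c<)
                         in i , out i< , g , e , subst (λ m → get R c < m ∸ sc D i) (sym (length-replicate n)) p
    ; covers = λ {q} q< → let c , c< , e = proj₁ (row q (0 , row-nonempty (subst (q <_) (length-replicate n) q<)))
                          in c , subst (c <_) (sym lenR) c< , e
    ; distinct = λ c< c'< → FullRook-injective n D R full (subst (_ <_) lenR c<) (subst (_ <_) lenR c'<)
    ; avoids = λ {i} {c₁} {c₂} {c₃} i≤ c< c<' c₃< g< d d' →
        let g<' = subst (λ m → get R c₁ < m ∸ sc D i) (length-replicate n) g<
        in avoid i (into i≤) (c₁ , c₂ , c₃ , c< , c<' ,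
             (<-trans c< (<-trans c<' c₃<) , g<') ,
             (<-trans c<' c₃< , <-trans d g<') ,
             (c₃< , <-trans d' (<-trans d g<')) , d , d')
    })

  module _ {R : List ℕ} {D₀ : List Bool} (u : Run (replicate n free) D R D₀) where

    private
      lenR : length R ≡ n
      lenR = trans (Run-length-columns u) ec-length

      vertex : ∀ i → i ≤ 2 * n → Vertex (replicate n free) D (take (ec D i) R) D₀ i
      vertex i i≤ = Run-vertex u (Inv-replicate n) (Ballot-replicate n) (out i≤)

      top' : ∀ {i} i≤ → length (state (vertex i i≤)) ≡ n ∸ sc D i
      top' {i} i≤ = trans (top (vertex i i≤)) (cong (_∸ sc D i) (length-replicate n))

    Run⇒R321 : R321 n D R
    Run⇒R321 = (lenR , inF , row) , avoid
      where
      inF : ∀ c → c < n → InF n D c (get R c)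
      inF c c< = let i , i< , g , e , p = Run-under u (subst (c <_) (sym lenR) c<)
                 in i , into i< , g , e , subst (λ m → get R c < m ∸ sc D i) (length-replicate n) p
      row : ∀ r → (∃[ c ] InF n D c r) → (∃[ c ] (c < n) × (get R c ≡ r)) ×
        (∀ c c' → c < n → c' < n → get R c ≡ r → get R c' ≡ r → c ≡ c')
      row r (c , p) with At-total (replicate n free) (subst (r <_) (sym (length-replicate n)) (InF⇒< n D p))
      ... | k , a with At-replicate n a
      ...   | refl = (let c , c< , e = Run-covers u a in c , subst (c <_) lenR c< , e) ,
                     λ c c' c< c'< e e' → Run-distinct u (subst (c <_) (sym lenR) c<)
                       (subst (c' <_) (sym lenR) c'<) (trans e (sym e'))
      avoid : Avoids321 n D R
      avoid i i≤ (c₁ , c₂ , c₃ , c< , c<' , (c₁< , g<) , (c₂< , _) , (c₃< , _) , d , d') =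
        no321 (inv v) c< c<'
          (subst (c₃ <_) (sym (trans (length-take (ec D i) R) (m≤n⇒m⊓n≡m ec≤))) c₃<)
          (subst₂ _<_ (sym (get-take (ec D i) R c₁<)) (sym (top' i≤)) g<)
          (subst₂ _<_ (sym (get-take (ec D i) R c₂<)) (sym (get-take (ec D i) R c₁<)) d)
          (subst₂ _<_ (sym (get-take (ec D i) R c₃<)) (sym (get-take (ec D i) R c₂<)) d')
        where
        v = vertex i i≤
        ec≤ : ec D i ≤ length R
        ec≤ = subst (ec D i ≤_) (sym (Run-length-columns u)) (ec-mono-≤ D (out i≤))

    private
      module _ (i : ℕ) (i≤ : i ≤ 2 * n) where
        σ = state (vertex i i≤)

        ht-state : ht D i ≡ + (firsts σ + seconds σ) - + 0
        ht-state with height (vertex i i≤)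
        ... | e rewrite firsts-replicate n | seconds-replicate n =
          difference-≡⁺ (ec D i) (sc D i) (firsts σ + seconds σ) 0 (trans (+-identityʳ _) e)

        ht₀-state : ht D₀ i ≡ + firsts σ - + seconds σ
        ht₀-state with height₀ (vertex i i≤)
        ... | e rewrite firsts-replicate n | seconds-replicate n | +-identityʳ (firsts σ) =
          difference-≡⁺ (ec D₀ i) (sc D₀ i) (firsts σ) (seconds σ) e

        ell-state : ell n D R i ≡ firsts σ
        ell-state = trans (cong (λ m → lis (filter (_<? m) (take (ec D i) R))) (sym (top' i≤)))
                          (LisOk-length σ (lis-ok (inv (vertex i i≤))))

    Run⇒jseq : ∀ i → i ≤ 2 * n → ht D₀ i ≡ jseq n D R i
    Run⇒jseq i i≤ = trans (ht₀-state i i≤)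
      (trans (go (firsts (σ i i≤)) (seconds (σ i i≤)))
             (sym (cong₂ (λ l h → + (2 * l) - h) (ell-state i i≤) (ht-state i i≤))))
      where
      go : ∀ f t → + f - + t ≡ + (2 * f) - (+ (f + t) - + 0)
      go f t = trans (difference-≡⁺ f t (2 * f) (f + t)
                 (trans (sym (+-assoc f f t)) (cong (_+ t) (cong (λ m → f + m) (sym (+-identityʳ f))))))
               (cong (λ z → + (2 * f) - z) (sym (ℤₚ.+-identityʳ (+ (f + t)))))

    Run⇒InD² : InD² n D D₀
    Run⇒InD² = (trans (Run-length-paths u) len , nonneg , end) , below
      where
      nonneg : ∀ i → i ≤ 2 * n → + 0 ℤ.≤ ht D₀ i
      nonneg i i≤ = subst (+ 0 ℤ.≤_) (sym (ht₀-state i i≤))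
        (ℤₚ.i≤j⇒0≤j-i (ℤ.+≤+ (Ballot-≤ (σ i i≤) (ballot (vertex i i≤)))))
      empty : ∀ s → length s ≡ 0 → + firsts s - + seconds s ≡ + 0
      empty [] _ = refl
      end : ht D₀ (2 * n) ≡ + 0
      end = trans (ht₀-state (2 * n) ≤-refl) (empty (σ (2 * n) ≤-refl)
        (trans (top' {2 * n} ≤-refl) (trans (cong (n ∸_) (proj₂ (Dyck-counts n D δ))) (n∸n≡0 n))))
      below : Below n D₀ D
      below i i≤ = subst₂ ℤ._≤_ (sym (ht₀-state i i≤)) (sym (ht-state i i≤))
        (difference-≤⁺ (firsts σᵢ) (seconds σᵢ) (firsts σᵢ + seconds σᵢ) 0
          (≤-trans (+-monoʳ-≤ (firsts σᵢ) z≤n) (m≤m+n _ _)))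
        where σᵢ = σ i i≤

  InD²⇒Run : ∀ {D₀} → InD² n D D₀ → ∃[ R ] Run (replicate n free) D R D₀
  InD²⇒Run {D₀} (δ₀ , below)
    with Run-exists D D₀ 0 0 (trans (proj₁ δ₀) (sym len))
           (λ i≤ → sc≤ec n D₀ δ₀ (into i≤))
           (λ {i} i≤ → subst (_≤ ec D i + sc D₀ i) (+-comm (ec D₀ i) (sc D i))
                   (difference-≤⁻ (ec D₀ i) (sc D₀ i) (ec D i) (sc D i) (below i (into i≤))))
           (subst (λ m → ec D₀ m ≡ sc D₀ m) (sym len)
             (let e , s = Dyck-counts n D₀ δ₀ in trans e (sym s)))
           (trans ec-length (sym sc-length))
  ... | s , R , u , f , t , _ =
        -- The initial state is an output of the reverse steps; having both rows empty, it must
        -- consist of `n` free labels.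
        R , subst (λ z → Run z D R D₀)
              (trans (no-labels⇒replicate s f t)
                     (cong (λ m → replicate m free) (trans (Run-length-rows u) sc-length))) u

-- Matchings

applyUpTo-cong : ∀ {A : Set} {f g : ℕ → A} k → (∀ i → i < k → f i ≡ g i) → applyUpTo f k ≡ applyUpTo g k
applyUpTo-cong zero _ = refl
applyUpTo-cong (suc k) e = cong₂ _∷_ (e 0 z<s) (applyUpTo-cong k (λ i i< → e (suc i) (s≤s i<)))

applyUpTo-get : ∀ xs → applyUpTo (get xs) (length xs) ≡ xs
applyUpTo-get [] = refl
applyUpTo-get (x ∷ xs) = cong (x ∷_) (applyUpTo-get xs)

applyUpTo-getB : ∀ D → applyUpTo (getB D) (length D) ≡ D
applyUpTo-getB [] = refl
applyUpTo-getB (b ∷ D) = cong (b ∷_) (applyUpTo-getB D)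

get-applyUpTo : ∀ (f : ℕ → ℕ) {k c} → c < k → get (applyUpTo f k) c ≡ f c
get-applyUpTo f {suc k} {zero} _ = refl
get-applyUpTo f {suc k} {suc c} (s≤s p) = get-applyUpTo (λ i → f (suc i)) p

get-ext : ∀ {xs ys k} → length xs ≡ k → length ys ≡ k → (∀ c → c < k → get xs c ≡ get ys c) → xs ≡ ys
get-ext {xs} {ys} refl e f = trans (sym (applyUpTo-get xs))
  (trans (applyUpTo-cong (length xs) f) (trans (cong (applyUpTo (get ys)) (sym e)) (applyUpTo-get ys)))

ec-suc : ∀ D {i} → getB D i ≡ true → ec D (suc i) ≡ suc (ec D i)
ec-suc (true ∷ D) {zero} _ = refl
ec-suc (true ∷ D) {suc i} e = cong suc (ec-suc D e)
ec-suc (false ∷ D) {suc i} e = ec-suc D e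

sc≡ec-not : ∀ D i → sc D i ≡ ec (map not D) i
sc≡ec-not D zero = refl
sc≡ec-not [] (suc i) = refl
sc≡ec-not (true ∷ D) (suc i) = sc≡ec-not D i
sc≡ec-not (false ∷ D) (suc i) = cong suc (sc≡ec-not D i)

getB-not : ∀ D {i} → i < length D → getB (map not D) i ≡ not (getB D i)
getB-not (b ∷ D) {zero} _ = refl
getB-not (b ∷ D) {suc i} (s≤s p) = getB-not D p

sc-mono-≤ : ∀ D {i j} → i ≤ j → sc D i ≤ sc D j
sc-mono-≤ D {i} {j} p = subst₂ _≤_ (sym (sc≡ec-not D i)) (sym (sc≡ec-not D j)) (ec-mono-≤ (map not D) p)

-- The guard matters: past the end `getB` returns `false` although there is no south step to count.
sc-suc : ∀ D {i} → i < length D → getB D i ≡ false → sc D (suc i) ≡ suc (sc D i)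
sc-suc D {i} i< e = trans (sc≡ec-not D (suc i))
  (trans (ec-suc (map not D) (trans (getB-not D i<) (cong not e))) (cong suc (sym (sc≡ec-not D i))))

ec-stays : ∀ D {i} → getB D i ≡ false → ec D (suc i) ≡ ec D i
ec-stays [] {zero} _ = refl
ec-stays [] {suc i} _ = refl
ec-stays (false ∷ D) {zero} _ = refl
ec-stays (true ∷ D) {suc i} e = cong suc (ec-stays D e)
ec-stays (false ∷ D) {suc i} e = ec-stays D e

sc-stays : ∀ D {i} → getB D i ≡ true → sc D (suc i) ≡ sc D i
sc-stays (true ∷ D) {zero} _ = refl
sc-stays (true ∷ D) {suc i} e = sc-stays D e
sc-stays (false ∷ D) {suc i} e = cong suc (sc-stays D e)

-- Reads a path off its heights. Being total, it defines the map on matchings for all lists, whereas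
-- a run is available only for avoiding placements.
steps : (ℕ → ℤ) → ℕ → List Bool
steps j k = applyUpTo (λ i → not ⌊ j (suc i) ℤ.≤? j i ⌋) k

steps-unique : ∀ {j k} D → length D ≡ k → (∀ i → i ≤ k → ht D i ≡ j i) → steps j k ≡ D
steps-unique {j} D refl e = trans (applyUpTo-cong (length D) go) (applyUpTo-getB D)
  where
  go : ∀ i → i < length D → not ⌊ j (suc i) ℤ.≤? j i ⌋ ≡ getB D i
  go i i< rewrite sym (e (suc i) i<) | sym (e i (<⇒≤ i<)) with ht D (suc i) ℤ.≤? ht D i | getB D i in g
  ... | yes _ | false = refl
  ... | no _ | true = refl
  ... | yes p | true = contradiction
        (subst₂ (λ a b → a + sc D i ≤ ec D i + b) (ec-suc D g) (sc-stays D g)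
          (difference-≤⁻ (ec D (suc i)) (sc D (suc i)) (ec D i) (sc D i) p))
        (<-irrefl refl)
  ... | no p | false = contradiction
        (difference-≤⁺ (ec D (suc i)) (sc D (suc i)) (ec D i) (sc D i)
          (subst₂ (λ a b → a + sc D i ≤ ec D i + b) (sym (ec-stays D g)) (sym (sc-suc D i< g))
            (+-monoʳ-≤ (ec D i) (n≤1+n _)))) p

-- Positions of steps, and the reversal of the rows

posE : List Bool → ℕ → ℕ
posE [] _ = 0
posE (true ∷ D) zero = 0
posE (true ∷ D) (suc c) = suc (posE D c)
posE (false ∷ D) c = suc (posE D c)

posE-ec : ∀ D {p} → getB D p ≡ true → posE D (ec D p) ≡ p
posE-ec (true ∷ D) {zero} _ = refl
posE-ec (true ∷ D) {suc p} e = cong suc (posE-ec D e)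
posE-ec (false ∷ D) {suc p} e = cong suc (posE-ec D e)

posE-< : ∀ D {c} → c < ec D (length D) → posE D c < length D
posE-< (true ∷ D) {zero} _ = z<s
posE-< (true ∷ D) {suc c} (s≤s p) = s≤s (posE-< D p)
posE-< (false ∷ D) p = s≤s (posE-< D p)

getB-posE : ∀ D {c} → c < ec D (length D) → getB D (posE D c) ≡ true
getB-posE (true ∷ D) {zero} _ = refl
getB-posE (true ∷ D) {suc c} (s≤s p) = getB-posE D p
getB-posE (false ∷ D) p = getB-posE D p

ec-posE : ∀ D {c} → c < ec D (length D) → ec D (posE D c) ≡ c
ec-posE (true ∷ D) {zero} _ = refl
ec-posE (true ∷ D) {suc c} (s≤s p) = cong suc (ec-posE D p)
ec-posE (false ∷ D) p = ec-posE D p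

posS : List Bool → ℕ → ℕ
posS D = posE (map not D)

index : List ℕ → ℕ → ℕ
index [] _ = 0
index (x ∷ xs) r with x ≟ r
... | yes _ = 0
... | no _ = suc (index xs r)

index-spec : ∀ xs {r} → Occurs xs r → index xs r < length xs × get xs (index xs r) ≡ r
index-spec (x ∷ xs) {r} o with x ≟ r
... | yes e = z<s , e
index-spec (x ∷ xs) (zero , _ , e) | no x≢r = contradiction e x≢r
index-spec (x ∷ xs) (suc c , s≤s c< , e) | no _ =
  let p , q = index-spec xs (c , c< , e) in s≤s p , q

-- The closer with s closers before it corresponds to row opposite n s.
opposite : ℕ → ℕ → ℕ
opposite n r = n ∸ suc r

opposite-< : ∀ {n r} → r < n → opposite n r < n
opposite-< {suc n} {r} _ = s≤s (m∸n≤m n r)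

opposite-involutive : ∀ {n r} → r < n → opposite n (opposite n r) ≡ r
opposite-involutive {suc n} (s≤s p) = m∸[m∸n]≡n p

opposite-anti-< : ∀ {n r r'} → r < r' → r' < n → opposite n r' < opposite n r
opposite-anti-< r<r' r'<n = ∸-monoʳ-< (s≤s r<r') r'<n

opposite-injective : ∀ {n r r'} → r < n → r' < n → opposite n r ≡ opposite n r' → r ≡ r'
opposite-injective {n} p p' e =
  trans (sym (opposite-involutive p)) (trans (cong (opposite n) e) (opposite-involutive p'))

-- With the converse below: after `s` south steps the row of a closer is still under the border
-- exactly when that closer is not among the first `s`.
opposite<∸⁻ : ∀ {n s t} → t < n → opposite n t < n ∸ s → s ≤ t
opposite<∸⁻ {n} t<n p = ≮⇒≥ (λ t<s → <⇒≱ p (∸-monoʳ-≤ n t<s))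

opposite<∸⁺ : ∀ {n s t} → t < n → s ≤ t → opposite n t < n ∸ s
opposite<∸⁺ t<n s≤t = ∸-monoʳ-< (s≤s s≤t) t<n

module Counts (D : List Bool) where

  ec-< : ∀ {p q} → getB D p ≡ true → p < q → ec D p < ec D q
  ec-< {p} {q} e p<q = subst (_≤ ec D q) (ec-suc D e) (ec-mono-≤ D p<q)

  ec-<⁻ : ∀ {p q} → ec D p < ec D q → p < q
  ec-<⁻ lt = ≰⇒> (λ q≤p → <⇒≱ lt (ec-mono-≤ D q≤p))

  sc-<⁻ : ∀ {p q} → sc D p < sc D q → p < q
  sc-<⁻ lt = ≰⇒> (λ q≤p → <⇒≱ lt (sc-mono-≤ D q≤p))

  ec-injective : ∀ {p p'} → getB D p ≡ true → getB D p' ≡ true → ec D p ≡ ec D p' → p ≡ p'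
  ec-injective e e' eq = trans (sym (posE-ec D e)) (trans (cong (posE D) eq) (posE-ec D e'))

-- Translation between matchings and placements

rooks : ℕ → List Bool → List ℕ → List ℕ
rooks n D M = applyUpTo (λ c → opposite n (sc D (get M (posE D c)))) n

partner : ℕ → List Bool → List ℕ → ℕ → ℕ
partner n D R i =
  if getB D i then posS D (opposite n (get R (ec D i)))
              else posE D (index R (opposite n (sc D i)))

matching : ℕ → List Bool → List ℕ → List ℕ
matching n D R = applyUpTo (partner n D R) (2 * n)

module _ {n : ℕ} {D : List Bool} (δ : Dyck n D) where

  private
    len : length D ≡ 2 * n
    len = proj₁ δ

    ec-end : ec D (2 * n) ≡ n
    ec-end = proj₁ (Dyck-counts n D δ)

    sc-end : sc D (2 * n) ≡ n
    sc-end = proj₂ (Dyck-counts n D δ)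

    out : ∀ {i} → i < 2 * n → i < length D
    out = subst (_ <_) (sym len)

    open Counts D

    opp : ℕ → ℕ
    opp = opposite n

    col< : ∀ {c} → c < n → c < ec D (length D)
    col< = subst (_ <_) (sym (trans (cong (ec D) len) ec-end))

    row< : ∀ {s} → s < n → s < ec (map not D) (length (map not D))
    row< = subst (_ <_) (sym (trans (cong (ec (map not D)) (trans (length-map not D) len))
                                    (trans (sym (sc≡ec-not D (2 * n))) sc-end)))

  posE-<2n : ∀ {c} → c < n → posE D c < 2 * n
  posE-<2n {c} c< = subst (posE D c <_) len (posE-< D (col< c<))

  posS-<2n : ∀ {s} → s < n → posS D s < 2 * n
  posS-<2n {s} s< = subst (posS D s <_) (trans (length-map not D) len) (posE-< (map not D) (row< s<))

  getB-posS : ∀ {s} → s < n → getB D (posS D s) ≡ false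
  getB-posS {s} s< = not-injective (trans (sym (getB-not D (out (posS-<2n s<)))) (getB-posE (map not D) (row< s<)))

  sc-posS : ∀ {s} → s < n → sc D (posS D s) ≡ s
  sc-posS {s} s< = trans (sc≡ec-not D (posS D s)) (ec-posE (map not D) (row< s<))

  posS-sc : ∀ {q} → q < 2 * n → getB D q ≡ false → posS D (sc D q) ≡ q
  posS-sc {q} q< e = trans (cong (posS D) (sc≡ec-not D q))
    (posE-ec (map not D) (trans (getB-not D (out q<)) (cong not e)))

  sc-< : ∀ {p q} → p < 2 * n → getB D p ≡ false → p < q → sc D p < sc D q
  sc-< {p} {q} p< e p<q = subst (_≤ sc D q) (sc-suc D (out p<) e) (sc-mono-≤ D p<q)

  ec-<n : ∀ {p} → p < 2 * n → getB D p ≡ true → ec D p < n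
  ec-<n p< e = subst (_ <_) ec-end (ec-< e p<)

  sc-<n : ∀ {q} → q < 2 * n → getB D q ≡ false → sc D q < n
  sc-<n q< e = subst (_ <_) sc-end (sc-< q< e q<)

  sc-≤⁻ : ∀ {i q} → q < 2 * n → getB D q ≡ false → sc D i ≤ sc D q → i ≤ q
  sc-≤⁻ q< e le = ≮⇒≥ (λ q<i → <⇒≱ (sc-< q< e q<i) le)

  sc-injective : ∀ {q q'} → q < 2 * n → q' < 2 * n → getB D q ≡ false → getB D q' ≡ false →
    sc D q ≡ sc D q' → q ≡ q'
  sc-injective q< q'< e e' eq = trans (sym (posS-sc q< e)) (trans (cong (posS D) eq) (posS-sc q'< e'))

  get-rooks : ∀ {M c} → c < n → get (rooks n D M) c ≡ opp (sc D (get M (posE D c)))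
  get-rooks {M} = get-applyUpTo (λ c → opp (sc D (get M (posE D c))))

  module Matching (M : List ℕ) (pm : PerfectMatching n M) (shape : HasShape n D M) where

    get< : ∀ {i} → i < 2 * n → get M i < 2 * n
    get< {i} = proj₁ (proj₂ pm) i

    get-get : ∀ {i} → i < 2 * n → get M (get M i) ≡ i
    get-get {i} = proj₂ (proj₂ (proj₂ pm)) i

    opener : ∀ {p} → p < 2 * n → getB D p ≡ true → p < get M p
    opener p< = proj₂ (shape _ p<)

    closer-partner : ∀ {p} → p < 2 * n → getB D p ≡ true → getB D (get M p) ≡ false
    closer-partner {p} p< e with getB D (get M p) in e'
    ... | false = refl
    ... | true = contradiction (subst (get M p <_) (get-get p<) (opener (get< p<) e')) (<-asym (opener p< e))

    opener-partner : ∀ {q} → q < 2 * n → getB D q ≡ false → getB D (get M q) ≡ true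
    opener-partner {q} q< e with <-cmp q (get M q)
    ... | tri≈ _ e' _ = contradiction (sym e') (proj₁ (proj₂ (proj₂ pm)) q q<)
    ... | tri> _ _ lt = proj₁ (shape _ (get< q<)) (subst (get M q <_) (sym (get-get q<)) lt)
    ... | tri< lt _ _ with trans (sym e) (proj₁ (shape q q<) lt)
    ...   | ()

    module _ {c} (c< : c < n) where
      p q : ℕ
      p = posE D c
      q = get M p

      p< : p < 2 * n
      p< = posE-<2n c<

      p-east : getB D p ≡ true
      p-east = getB-posE D (col< c<)

      ec-p : ec D p ≡ c
      ec-p = ec-posE D (col< c<)

      q< : q < 2 * n
      q< = get< p<

      q-south : getB D q ≡ false
      q-south = closer-partner p< p-east

      sc-q<n : sc D q < n
      sc-q<n = sc-<n q< q-south

  rooks-FullRook : ∀ {M} → PerfectMatching n M → HasShape n D M → FullRook n D (rooks n D M)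
  rooks-FullRook {M} pm shape = length-applyUpTo _ n , inF , row
    where
    open Matching M pm shape
    inF : ∀ c → c < n → InF n D c (get (rooks n D M) c)
    inF c c< = p c< , p< c< , p-east c< , ec-p c< ,
      subst (_< n ∸ sc D (p c<)) (sym (get-rooks {M} c<))
        (opposite<∸⁺ (sc-q<n c<) (sc-mono-≤ D (<⇒≤ (opener (p< c<) (p-east c<)))))
    row : ∀ r → (∃[ c ] InF n D c r) → (∃[ c ] (c < n) × (get (rooks n D M) c ≡ r)) ×
      (∀ c c' → c < n → c' < n → get (rooks n D M) c ≡ r → get (rooks n D M) c' ≡ r → c ≡ c')
    row r (_ , f) = (ec D i , i-col< , hits) , unique
      where
      s<n : opp r < n
      s<n = opposite-< (InF⇒< n D f)
      j = posS D (opp r)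
      j< : j < 2 * n
      j< = posS-<2n s<n
      i = get M j
      i-east : getB D i ≡ true
      i-east = opener-partner j< (getB-posS s<n)
      i-col< : ec D i < n
      i-col< = ec-<n (get< j<) i-east
      hits : get (rooks n D M) (ec D i) ≡ r
      hits = begin
        get (rooks n D M) (ec D i)                    ≡⟨ get-rooks {M} i-col< ⟩
        opp (sc D (get M (posE D (ec D i))))      ≡⟨ cong (λ m → opp (sc D (get M m))) (posE-ec D i-east) ⟩
        opp (sc D (get M (get M j)))              ≡⟨ cong (λ m → opp (sc D m)) (get-get j<) ⟩
        opp (sc D j)                              ≡⟨ cong opp (sc-posS s<n) ⟩
        opp (opp r)                               ≡⟨ opposite-involutive (InF⇒< n D f) ⟩
        r                                         ∎
        where open ≡-Reasoning
      unique : ∀ c c' → c < n → c' < n → get (rooks n D M) c ≡ r → get (rooks n D M) c' ≡ r → c ≡ c'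
      unique c c' c< c'< e e' = trans (sym (ec-p c<)) (trans (cong (ec D) p≡) (ec-p c'<))
        where
        q≡ : q c< ≡ q c'<
        q≡ = sc-injective (q< c<) (q< c'<) (q-south c<) (q-south c'<)
          (opposite-injective (sc-q<n c<) (sc-q<n c'<)
            (trans (sym (get-rooks {M} c<)) (trans e (trans (sym e') (get-rooks {M} c'<)))))
        p≡ : p c< ≡ p c'<
        p≡ = trans (sym (get-get (p< c<))) (trans (cong (get M) q≡) (get-get (p< c'<)))

  -- A rook in `Γ(V_i)` has its opener before `i` and its closer at `i` or later. So the three
  -- openers precede the three closers, and decreasing rows are increasing closers.
  rooks-R321 : ∀ {M} → M321 n D M → R321 n D (rooks n D M)
  rooks-R321 {M} (pm , shape , avoid) = rooks-FullRook {M} pm shape , avoid'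
    where
    open Matching M pm shape
    avoid' : Avoids321 n D (rooks n D M)
    avoid' i i≤ (c₁ , c₂ , c₃ , c₁<c₂ , c₂<c₃ , (c₁<X , r₁<Y) , (c₂<X , _) , (c₃<X , _) , r₂<r₁ , r₃<r₂) =
      avoid (p a , p b , p c , q a , q b , q c ,
        ec-<⁻ (subst₂ _<_ (sym (ec-p a)) (sym (ec-p b)) c₁<c₂) ,
        ec-<⁻ (subst₂ _<_ (sym (ec-p b)) (sym (ec-p c)) c₂<c₃) ,
        <-≤-trans (ec-<⁻ {q = i} (subst (_< ec D i) (sym (ec-p c)) c₃<X))
          (sc-≤⁻ (q< a) (q-south a) (opposite<∸⁻ (sc-q<n a) (subst (_< n ∸ sc D i) (get-rooks {M} a) r₁<Y))) ,
        row-< a b r₂<r₁ , row-< b c r₃<r₂ , q< c , refl , refl , refl)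
      where
      bound : ∀ {c} → c < ec D i → c < n
      bound c<X = <-≤-trans c<X (subst (ec D i ≤_) ec-end (ec-mono-≤ D i≤))
      a = bound c₁<X
      b = bound c₂<X
      c = bound c₃<X
      row-< : ∀ {c c'} (c< : c < n) (c'< : c' < n) → get (rooks n D M) c' < get (rooks n D M) c → q c< < q c'<
      row-< c< c'< lt = sc-<⁻ (≰⇒> λ le → <⇒≱
        (subst₂ _<_ (get-rooks {M} c'<) (get-rooks {M} c<) lt) (∸-monoʳ-≤ n (s≤s le)))

  -- The rooks name the partners of the openers; those of the closers follow because a matching is
  -- an involution.
  rooks-injective : ∀ {M M'} → M321 n D M → M321 n D M' → rooks n D M ≡ rooks n D M' → M ≡ M'
  rooks-injective {M} {M'} (pm , shape , _) (pm' , shape' , _) eq = get-ext (proj₁ pm) (proj₁ pm') same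
    where
    module 𝓜 = Matching M pm shape
    module 𝓜' = Matching M' pm' shape'
    same-opener : ∀ p → p < 2 * n → getB D p ≡ true → get M p ≡ get M' p
    same-opener p p< e = sc-injective (𝓜.get< p<) (𝓜'.get< p<) south south'
      (opposite-injective (sc-<n (𝓜.get< p<) south) (sc-<n (𝓜'.get< p<) south')
        (trans (rook M) (trans (cong (λ R → get R (ec D p)) eq) (sym (rook M')))))
      where
      south = 𝓜.closer-partner p< e
      south' = 𝓜'.closer-partner p< e
      rook : ∀ M → opp (sc D (get M p)) ≡ get (rooks n D M) (ec D p)
      rook M = sym (trans (get-rooks {M} (ec-<n p< e)) (cong (λ m → opp (sc D (get M m))) (posE-ec D e)))
    same : ∀ i → i < 2 * n → get M i ≡ get M' i
    same i i< with getB D i in e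
    ... | true = same-opener i i< e
    ... | false = sym (trans (cong (get M') i≡) (𝓜'.get-get (𝓜.get< i<)))
      where
      i≡ : i ≡ get M' (get M i)
      i≡ = trans (sym (𝓜.get-get i<)) (same-opener (get M i) (𝓜.get< i<) (𝓜.opener-partner i< e))

  module Placement (R : List ℕ) (full : FullRook n D R) where

    M : List ℕ
    M = matching n D R

    module _ {i} (i< : i < 2 * n) (e : getB D i ≡ true) where
      row-<n : get R (ec D i) < n
      row-<n = InF⇒< n D (proj₁ (proj₂ full) (ec D i) (ec-<n i< e))

      get-opener : get M i ≡ posS D (opp (get R (ec D i)))
      get-opener = trans (get-applyUpTo (partner n D R) i<)
        (cong (λ b → if b then posS D (opp (get R (ec D i))) else posE D (index R (opp (sc D i)))) e)

      opener-south : getB D (get M i) ≡ false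
      opener-south = trans (cong (getB D) get-opener) (getB-posS (opposite-< row-<n))

      opener-sc : sc D (get M i) ≡ opp (get R (ec D i))
      opener-sc = trans (cong (sc D) get-opener) (sc-posS (opposite-< row-<n))

      opener-<2n : get M i < 2 * n
      opener-<2n = subst (_< 2 * n) (sym get-opener) (posS-<2n (opposite-< row-<n))

      opener-< : i < get M i
      opener-< = ≤∧≢⇒< (sc-≤⁻ opener-<2n opener-south (subst (sc D i ≤_) (sym opener-sc) above)) i≢
        where
        above : sc D i ≤ opp (get R (ec D i))
        above with proj₁ (proj₂ full) (ec D i) (ec-<n i< e)
        -- The east step that witnesses `InF` is step `i` itself, as each column has only one.
        ... | j , j< , e' , ec≡ , r< with ec-injective e' e ec≡
        ...   | refl = opposite<∸⁻ (opposite-< row-<n)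
                         (subst (_< n ∸ sc D i) (sym (opposite-involutive row-<n)) r<)
        i≢ : i ≢ get M i
        i≢ i≡ with trans (sym e) (trans (cong (getB D) i≡) opener-south)
        ... | ()

    module _ {i} (i< : i < 2 * n) (e : getB D i ≡ false) where
      col : ℕ
      col = index R (opp (sc D i))

      private
        spec : col < length R × get R col ≡ opp (sc D i)
        spec = let c , c< , e' = proj₁ (proj₂ (proj₂ full) _ (0 , row-nonempty δ (opposite-< (sc-<n i< e))))
               in index-spec R (c , subst (c <_) (sym (proj₁ full)) c< , e')

      col-<n : col < n
      col-<n = subst (col <_) (proj₁ full) (proj₁ spec)

      get-col : get R col ≡ opp (sc D i)
      get-col = proj₂ spec

      get-closer : get M i ≡ posE D col
      get-closer = trans (get-applyUpTo (partner n D R) i<)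
        (cong (λ b → if b then posS D (opp (get R (ec D i))) else posE D (index R (opp (sc D i)))) e)

      closer-east : getB D (get M i) ≡ true
      closer-east = trans (cong (getB D) get-closer) (getB-posE D (col< col-<n))

      closer-<2n : get M i < 2 * n
      closer-<2n = subst (_< 2 * n) (sym get-closer) (posE-<2n col-<n)

      closer-ec : ec D (get M i) ≡ col
      closer-ec = trans (cong (ec D) get-closer) (ec-posE D (col< col-<n))

    partner-<2n : ∀ i → i < 2 * n → get M i < 2 * n
    partner-<2n i i< with getB D i in e
    ... | true = opener-<2n i< e
    ... | false = closer-<2n i< e

    partner-≢ : ∀ i → i < 2 * n → ¬ (get M i ≡ i)
    partner-≢ i i< eq with getB D i in e
    ... | true = contradiction (trans (sym (trans (cong (getB D) eq) e)) (opener-south i< e)) λ ()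
    ... | false = contradiction (trans (sym (trans (cong (getB D) eq) e)) (closer-east i< e)) λ ()

    partner-involutive : ∀ i → i < 2 * n → get M (get M i) ≡ i
    partner-involutive i i< with getB D i in e
    ... | true = trans (get-closer j< south) (trans (cong (posE D) col≡) (posE-ec D e))
      where
      j< = opener-<2n i< e
      south = opener-south i< e
      col≡ : col j< south ≡ ec D i
      col≡ = FullRook-injective n D R full (col-<n j< south) (ec-<n i< e)
        (trans (get-col j< south) (trans (cong opp (opener-sc i< e)) (opposite-involutive (row-<n i< e))))
    ... | false = begin
        get M (get M i)                      ≡⟨ get-opener j< (closer-east i< e) ⟩
        posS D (opp (get R (ec D (get M i))))  ≡⟨ cong (λ c → posS D (opp (get R c))) (closer-ec i< e) ⟩
        posS D (opp (get R (col i< e)))        ≡⟨ cong (λ r → posS D (opp r)) (get-col i< e) ⟩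
        posS D (opp (opp (sc D i)))            ≡⟨ cong (posS D) (opposite-involutive (sc-<n i< e)) ⟩
        posS D (sc D i)                        ≡⟨ posS-sc i< e ⟩
        i                                    ∎
      where
      open ≡-Reasoning
      j< = closer-<2n i< e

    perfect : PerfectMatching n M
    perfect = length-applyUpTo _ (2 * n) , partner-<2n , partner-≢ , partner-involutive

    shape : HasShape n D M
    shape i i< = east-if , opener-< i<
      where
      east-if : i < get M i → getB D i ≡ true
      east-if lt with getB D i in e
      ... | true = refl
      ... | false = contradiction
            (subst (get M i <_) (partner-involutive i i<) (opener-< (closer-<2n i< e) (closer-east i< e)))
            (<-asym lt)

    rooks-matching : rooks n D M ≡ R
    rooks-matching = get-ext (length-applyUpTo _ n) (proj₁ full) λ c c< →
      let p< = posE-<2n c<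
          e = getB-posE D (col< c<)
      in begin
        get (rooks n D M) c                      ≡⟨ get-rooks {M} c< ⟩
        opp (sc D (get M (posE D c)))        ≡⟨ cong opp (opener-sc p< e) ⟩
        opp (opp (get R (ec D (posE D c))))  ≡⟨ opposite-involutive (row-<n p< e) ⟩
        get R (ec D (posE D c))              ≡⟨ cong (get R) (ec-posE D (col< c<)) ⟩
        get R c                              ∎
      where open ≡-Reasoning

    -- The 321 is seen at the vertex before the closer `i₄`: the three openers have been read, and
    -- the row closed by `i₄` is the highest one still under the border.
    avoids : Avoids321 n D R → Avoids321M n M
    avoids avoid (i₁ , i₂ , i₃ , i₄ , i₅ , i₆ , lt₁ , lt₂ , lt₃ , lt₄ , lt₅ , i₆< , refl , refl , refl) =
      avoid i₄ (<⇒≤ i₄<) (ec D i₁ , ec D i₂ , ec D i₃ , ec-< east₁ lt₁ , ec-< east₂ lt₂ ,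
        (<-trans (ec-< east₁ lt₁) (<-trans (ec-< east₂ lt₂) (ec-< east₃ lt₃)) , r₁<Y) ,
        (<-trans (ec-< east₂ lt₂) (ec-< east₃ lt₃) , <-trans d r₁<Y) ,
        (ec-< east₃ lt₃ , <-trans d' (<-trans d r₁<Y)) , d , d')
      where
      i₅< = <-trans lt₅ i₆<
      i₄< = <-trans lt₄ i₅<
      i₃< = <-trans lt₃ i₄<
      i₂< = <-trans lt₂ i₃<
      i₁< = <-trans lt₁ i₂<
      east₁ = proj₁ (shape i₁ i₁<) (<-trans lt₁ (<-trans lt₂ lt₃))
      east₂ = proj₁ (shape i₂ i₂<) (<-trans lt₂ (<-trans lt₃ lt₄))
      east₃ = proj₁ (shape i₃ i₃<) (<-trans lt₃ (<-trans lt₄ lt₅))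
      rook : ∀ {i} (i< : i < 2 * n) (e : getB D i ≡ true) → opp (sc D (get M i)) ≡ get R (ec D i)
      rook i< e = trans (cong opp (opener-sc i< e)) (opposite-involutive (row-<n i< e))
      desc : ∀ {i j} (i< : i < 2 * n) (j< : j < 2 * n) (e : getB D i ≡ true) (e' : getB D j ≡ true) →
        get M i < get M j → get R (ec D j) < get R (ec D i)
      desc i< j< e e' lt = subst₂ _<_ (rook j< e') (rook i< e)
        (opposite-anti-< (sc-< (opener-<2n i< e) (opener-south i< e) lt)
          (sc-<n (opener-<2n j< e') (opener-south j< e')))
      d = desc i₁< i₂< east₁ east₂ lt₄
      d' = desc i₂< i₃< east₂ east₃ lt₅
      r₁<Y : get R (ec D i₁) < n ∸ sc D (get M i₁)
      r₁<Y = subst (_< n ∸ sc D (get M i₁)) (rook i₁< east₁)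
        (opposite<∸⁺ (sc-<n i₄< (opener-south i₁< east₁)) ≤-refl)

theorem3p4 : (n : ℕ) (D : List Bool) → Dyck n D →
    ((R : List ℕ) → R321 n D R →
    Σ (List Bool) λ D₀ → InD² n D D₀ × (∀ i → i ≤ 2 * n → ht D₀ i ≡ jseq n D R i))
    × ((R R' : List ℕ) → R321 n D R → R321 n D R' →
    (∀ i → i ≤ 2 * n → jseq n D R i ≡ jseq n D R' i) → R ≡ R')
    × ((D₀ : List Bool) → InD² n D D₀ →
    Σ (List ℕ) λ R → R321 n D R × (∀ i → i ≤ 2 * n → ht D₀ i ≡ jseq n D R i))
    × Σ (List ℕ → List Bool) (λ f →
    ((M : List ℕ) → M321 n D M → InD² n D (f M))
    × ((M M' : List ℕ) → M321 n D M → M321 n D M' → f M ≡ f M' → M ≡ M')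
    × ((D₀ : List Bool) → InD² n D D₀ → Σ (List ℕ) λ M → M321 n D M × f M ≡ D₀))
theorem3p4 n D δ = defined , injective , surjective , f , (λ M μ → proj₁ (f-spec M μ)) , f-injective , f-surjective
  where
  defined : (R : List ℕ) → R321 n D R →
    Σ (List Bool) λ D₀ → InD² n D D₀ × (∀ i → i ≤ 2 * n → ht D₀ i ≡ jseq n D R i)
  defined R ρ = let D₀ , u = R321⇒Run δ {R} ρ in D₀ , Run⇒InD² δ u , Run⇒jseq δ u

  Run-injective : ∀ {R R' D₀ D₀'} → Run (replicate n free) D R D₀ → Run (replicate n free) D R' D₀' →
    (∀ i → i ≤ 2 * n → jseq n D R i ≡ jseq n D R' i) → R ≡ R'
  Run-injective {R} {R'} {D₀} {D₀'} u u' j≡ =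
    proj₂ (Run-unique u (subst (Run (replicate n free) D R') (sym D₀≡) u'))
    where
    D₀≡ : D₀ ≡ D₀'
    D₀≡ = trans (sym (steps-unique D₀ (proj₁ (proj₁ (Run⇒InD² δ u))) (Run⇒jseq δ u)))
      (steps-unique D₀' (proj₁ (proj₁ (Run⇒InD² δ u')))
        (λ i i≤ → trans (Run⇒jseq δ u' i i≤) (sym (j≡ i i≤))))

  injective : (R R' : List ℕ) → R321 n D R → R321 n D R' →
    (∀ i → i ≤ 2 * n → jseq n D R i ≡ jseq n D R' i) → R ≡ R'
  injective R R' ρ ρ' = Run-injective (proj₂ (R321⇒Run δ {R} ρ)) (proj₂ (R321⇒Run δ {R'} ρ'))

  surjective : (D₀ : List Bool) → InD² n D D₀ →
    Σ (List ℕ) λ R → R321 n D R × (∀ i → i ≤ 2 * n → ht D₀ i ≡ jseq n D R i)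
  surjective D₀ ι = let R , u = InD²⇒Run δ ι in R , Run⇒R321 δ u , Run⇒jseq δ u

  f : List ℕ → List Bool
  f M = steps (jseq n D (rooks n D M)) (2 * n)

  f≡ : ∀ {M D₀} → InD² n D D₀ → (∀ i → i ≤ 2 * n → ht D₀ i ≡ jseq n D (rooks n D M) i) → f M ≡ D₀
  f≡ {D₀ = D₀} ι = steps-unique D₀ (proj₁ (proj₁ ι))

  f-spec : ∀ M → M321 n D M → InD² n D (f M) × (∀ i → i ≤ 2 * n → ht (f M) i ≡ jseq n D (rooks n D M) i)
  f-spec M μ =
    let D₀ , ι , j≡ = defined (rooks n D M) (rooks-R321 δ {M} μ)
    in subst (λ z → InD² n D z × (∀ i → i ≤ 2 * n → ht z i ≡ jseq n D (rooks n D M) i))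
             (sym (f≡ {M} ι j≡)) (ι , j≡)

  f-injective : (M M' : List ℕ) → M321 n D M → M321 n D M' → f M ≡ f M' → M ≡ M'
  f-injective M M' μ μ' eq =
    rooks-injective δ {M} {M'} μ μ'
      (injective (rooks n D M) (rooks n D M') (rooks-R321 δ {M} μ) (rooks-R321 δ {M'} μ') λ i i≤ →
        trans (sym (proj₂ (f-spec M μ) i i≤))
              (trans (cong (λ z → ht z i) eq) (proj₂ (f-spec M' μ') i i≤)))

  f-surjective : (D₀ : List Bool) → InD² n D D₀ → Σ (List ℕ) λ M → M321 n D M × f M ≡ D₀
  f-surjective D₀ ι = M , (perfect , shape , avoids avoid) ,
    f≡ {M} ι (λ i i≤ → trans (j≡ i i≤) (cong (λ z → jseq n D z i) (sym rooks-matching)))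
    where
    R = proj₁ (surjective D₀ ι)
    full = proj₁ (proj₁ (proj₂ (surjective D₀ ι)))
    avoid = proj₂ (proj₁ (proj₂ (surjective D₀ ι)))
    j≡ = proj₂ (proj₂ (surjective D₀ ι))
    open Placement δ R full
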